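{- Let $(\alpha_1,\alpha_2)$ be a pair of partitions and $r$ a positive integer. Then \[ \tau^r_{\alpha_1,\alpha_2}=w_{\alpha_1,\alpha_2}+\sum_{a}w_{t(a)}, \] where the sum runs over the arrows $a$ of the Remmel–Whitney quiver with source $(\alpha_1,\alpha_2)$ that satisfy the reverse $r$-th row rule.
   Context: Tableaux: English Young diagrams (rows numbered top to bottom, columns left to right); standard tableaux of shape $\alpha/\beta$ are fillings by $1,\dots,|\alpha|-|\beta|$ increasing along rows and columns. $\mathrm{rl}(\alpha/\beta)$ writes $1,\dots,|\alpha/\beta|$ into $\alpha/\beta$ right to left along rows, rows top to bottom. $\mathrm{RW}_{\gamma/\delta}(\alpha/\beta)$: standard tableaux $T$ of shape $\gamma/\delta$ such that if $i,i+1$ share a row of $\mathrm{rl}(\alpha/\beta)$ then $i+1$ is strictly right of and weakly above $i$ in $T$, and if $i$ is directly above $j$ in a column of $\mathrm{rl}(\alpha/\beta)$ then $j$ is strictly below and weakly left of $i$ in $T$. In $\Lambda_1\otimes_{\mathbb Z}\Lambda_2$ (symmetric functions in $x$'s and $y$'s), $s_{\alpha_1,\alpha_2}=s_{\alpha_1}(x)s_{\alpha_2}(y)$. Remmel–Whitney quiver: vertices pairs of partitions, and for distinct pairs with $\alpha_1\subseteq\beta_1$, $\beta_2\subseteq\alpha_2$ one arrow $a_T:(\alpha_1,\alpha_2)\to(\beta_1,\beta_2)$ for each $T\in\mathrm{RW}_{\beta_1/\alpha_1}(\alpha_2/\beta_2)$; $t(a)$ is the target. The Remmel–Whitney basis: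 $w_{\alpha_1,\alpha_2}=s_{\alpha_1,\alpha_2}-\sum_{a}w_{t(a)}$ over all arrows with source $(\alpha_1,\alpha_2)$ (recursive in $|\alpha_2|$). The $r$-th row rule filling of a partition has $r+i-j$ in row $i$, column $j$. For $a_T$ and each $i\in\{1,\dots,|\beta_1|-|\alpha_1|\}$, $R_r(i)$ is the entry of the row rule filling of $\alpha_2$ at the box of $\alpha_2/\beta_2$ labelled $i$ in $\mathrm{rl}(\alpha_2/\beta_2)$, and $\mathrm{row}_T(i)$ the row of $i$ in $T$; $a_T$ satisfies the $r$-th row rule if $R_r(i)\le\mathrm{row}_T(i)$ for all $i$, and the reverse $r$-th row rule if $R_r(i)>\mathrm{row}_T(i)$ for all $i$. The basis $\tau^r_{\alpha_1,\alpha_2}=s_{\alpha_1,\alpha_2}-\sum_a\tau^r_{t(a)}$ (recursively), over arrows with source $(\alpha_1,\alpha_2)$ satisfying the $r$-th row rule. -}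

module Defs where

-- Remmel–Whitney quiver, the Remmel–Whitney basis w and the row-rule bases τ^r.
-- Conventions: partitions are lists of positive, weakly decreasing naturals
-- (no trailing zeros); boxes are (row , column), both 1-indexed, English notation.
-- An element of Λ₁ ⊗_ℤ Λ₂ is represented by its coordinate function in the
-- ℤ-basis { s_{α₁,α₂} }.

open import Data.Nat as ℕ using (ℕ; zero; suc; _+_; _∸_; _⊓_)
open import Data.Integer as ℤ using (ℤ; +_; 0ℤ; 1ℤ)
open import Data.Bool using (Bool; true; false; _∧_; _∨_; not; if_then_else_)
open import Data.List using (List; []; _∷_; map; concatMap; length; reverse; zip; applyUpTo; upTo; foldr)
open import Data.Nat.ListAction using (sum)
open import Data.Product using (_×_; _,_; proj₁; proj₂)

filterᵇ : {A : Set} → (A → Bool) → List A → List A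
filterᵇ p [] = []
filterᵇ p (x ∷ xs) = if p x then x ∷ filterᵇ p xs else filterᵇ p xs

allᵇ : {A : Set} → (A → Bool) → List A → Bool
allᵇ p [] = true
allᵇ p (x ∷ xs) = p x ∧ allᵇ p xs

pairsOf : {A : Set} → List A → List (A × A)
pairsOf xs = concatMap (λ x → map (λ y → x , y) xs) xs

labelled : {A : Set} → List A → List (ℕ × A)
labelled xs = zip (applyUpTo suc (length xs)) xs

insertAll : {A : Set} → A → List A → List (List A)
insertAll x [] = (x ∷ []) ∷ []
insertAll x (y ∷ ys) = (x ∷ y ∷ ys) ∷ map (y ∷_) (insertAll x ys)

permutations : {A : Set} → List A → List (List A)
permutations [] = [] ∷ []
permutations (x ∷ xs) = concatMap (insertAll x) (permutations xs)

at : List ℕ → ℕ → ℕ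
at [] _ = 0
at (x ∷ xs) zero = x
at (x ∷ xs) (suc n) = at xs n

eqList : List ℕ → List ℕ → Bool
eqList [] [] = true
eqList [] (_ ∷ _) = false
eqList (_ ∷ _) [] = false
eqList (x ∷ xs) (y ∷ ys) = (x ℕ.≡ᵇ y) ∧ eqList xs ys

Partition : Set
Partition = List ℕ

isPartition : List ℕ → Bool
isPartition [] = true
isPartition (x ∷ []) = 1 ℕ.≤ᵇ x
isPartition (x ∷ y ∷ xs) = (y ℕ.≤ᵇ x) ∧ isPartition (y ∷ xs)

size : Partition → ℕ
size = sum

rowLen : Partition → ℕ → ℕ
rowLen λ' i = at λ' (i ∸ 1)

_⊆ᵇ_ : Partition → Partition → Bool
[] ⊆ᵇ _ = true
(b ∷ bs) ⊆ᵇ [] = false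
(b ∷ bs) ⊆ᵇ (a ∷ as) = (b ℕ.≤ᵇ a) ∧ (bs ⊆ᵇ as)

-- partitions of n with parts ≤ m (first argument is fuel ≥ n)
partsBounded : ℕ → ℕ → ℕ → List Partition
partsBounded _ zero _ = [] ∷ []
partsBounded zero (suc n) _ = []
partsBounded (suc f) (suc n) m =
  concatMap (λ j → map (j ∷_) (partsBounded f (suc n ∸ j) j))
            (applyUpTo suc (m ⊓ suc n))

partitionsOf : ℕ → List Partition
partitionsOf n = partsBounded n n n

subPartitions : Partition → List Partition
subPartitions α = filterᵇ (λ β → β ⊆ᵇ α) (concatMap partitionsOf (upTo (suc (size α))))

Box : Set
Box = ℕ × ℕ   -- (row , column), 1-indexed

skewRow : Partition → Partition → ℕ → List ℕ
skewRow α β i = applyUpTo (λ t → suc (rowLen β i + t)) (rowLen α i ∸ rowLen β i)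

skewBoxes : Partition → Partition → List Box
skewBoxes α β = concatMap (λ i → map (λ c → i , c) (skewRow α β i)) (applyUpTo suc (length α))

-- rl(α/β): the box labelled k is the k-th element of this list
-- (right to left along rows, rows top to bottom)
rlBoxes : Partition → Partition → List Box
rlBoxes α β = concatMap (λ i → map (λ c → i , c) (reverse (skewRow α β i))) (applyUpTo suc (length α))

-- A filling by 1,…,n: the k-th element of the list is the box containing k.
Tableau : Set
Tableau = List Box

posOf : Tableau → ℕ → Box
posOf [] _ = 0 , 0
posOf (b ∷ bs) zero = 0 , 0
posOf (b ∷ bs) (suc zero) = b
posOf (b ∷ bs) (suc (suc k)) = posOf bs (suc k)

rowOf colOf : Tableau → ℕ → ℕ
rowOf T k = proj₁ (posOf T k)
colOf T k = proj₂ (posOf T k)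

isStandardFilling : Tableau → Bool
isStandardFilling T = allᵇ ok (pairsOf (labelled T))
  where
  ok : (ℕ × Box) × (ℕ × Box) → Bool
  ok ((i , (ri , ci)) , (j , (rj , cj))) =
    (not ((ri ℕ.≡ᵇ rj) ∧ (ci ℕ.<ᵇ cj)) ∨ (i ℕ.<ᵇ j)) ∧
    (not ((ci ℕ.≡ᵇ cj) ∧ (ri ℕ.<ᵇ rj)) ∨ (i ℕ.<ᵇ j))

standardTableaux : Partition → Partition → List Tableau
standardTableaux γ δ = filterᵇ isStandardFilling (permutations (skewBoxes γ δ))

rwCondition : Partition → Partition → Tableau → Bool
rwCondition α β T = allᵇ ok (pairsOf (labelled (rlBoxes α β)))
  where
  ok : (ℕ × Box) × (ℕ × Box) → Bool
  ok ((i , (ri , ci)) , (j , (rj , cj))) =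
    (not ((j ℕ.≡ᵇ suc i) ∧ (ri ℕ.≡ᵇ rj))
      ∨ ((colOf T i ℕ.<ᵇ colOf T j) ∧ (rowOf T j ℕ.≤ᵇ rowOf T i))) ∧
    (not ((rj ℕ.≡ᵇ suc ri) ∧ (cj ℕ.≡ᵇ ci))
      ∨ ((rowOf T i ℕ.<ᵇ rowOf T j) ∧ (colOf T j ℕ.≤ᵇ colOf T i)))

RW : Partition → Partition → Partition → Partition → List Tableau
RW γ δ α β =
  if length (skewBoxes γ δ) ℕ.≡ᵇ length (rlBoxes α β)
  then filterᵇ (rwCondition α β) (standardTableaux γ δ)
  else []

Pair : Set
Pair = Partition × Partition

eqPair : Pair → Pair → Bool
eqPair (a , b) (c , d) = eqList a c ∧ eqList b d

record Arrow : Set where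
  constructor arrow
  field
    target  : Pair
    tableau : Tableau   -- T ∈ RW_{β₁/α₁}(α₂/β₂)
open Arrow public

arrowsFrom : Pair → List Arrow
arrowsFrom (α₁ , α₂) =
  concatMap
    (λ β₂ → concatMap
       (λ β₁ → if eqPair (β₁ , β₂) (α₁ , α₂) then []
               else map (arrow (β₁ , β₂)) (RW β₁ α₁ α₂ β₂))
       (filterᵇ (λ β₁ → α₁ ⊆ᵇ β₁) (partitionsOf (size α₁ + (size α₂ ∸ size β₂)))))
    (subPartitions α₂)

-- R_r(i) for the arrow a (source (α₁ , α₂)) and label i: entry r + row − col of the
-- r-th row rule filling of α₂ at the box labelled i in rl(α₂/β₂)
rowRuleValues : ℕ → Pair → Arrow → List (ℤ × ℕ)
rowRuleValues r (α₁ , α₂) a =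
  map (λ { (i , (ri , ci)) → ((+ (r + ri)) ℤ.- (+ ci)) , rowOf (tableau a) i })
      (labelled (rlBoxes α₂ (proj₂ (target a))))

satisfiesRowRule : ℕ → Pair → Arrow → Bool
satisfiesRowRule r p a = allᵇ (λ { (R , row) → R ℤ.≤ᵇ (+ row) }) (rowRuleValues r p a)

satisfiesReverseRowRule : ℕ → Pair → Arrow → Bool
satisfiesReverseRowRule r p a = allᵇ (λ { (R , row) → not (R ℤ.≤ᵇ (+ row)) }) (rowRuleValues r p a)

-- Λ₁ ⊗ Λ₂, via coordinates in the basis s_{α₁,α₂}

Elt : Set
Elt = Pair → ℤ

s : Pair → Elt
s p q = if eqPair p q then 1ℤ else 0ℤ

_+ᴱ_ _-ᴱ_ : Elt → Elt → Elt
(x +ᴱ y) q = x q ℤ.+ y q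
(x -ᴱ y) q = x q ℤ.- y q

0ᴱ : Elt
0ᴱ _ = 0ℤ

Σᴱ : List Elt → Elt
Σᴱ = foldr _+ᴱ_ 0ᴱ

-- recursion in |α₂| (fuel; |α₂| + 1 always suffices since targets have smaller |β₂|)
wFuel : ℕ → Pair → Elt
wFuel zero p = s p
wFuel (suc f) p = s p -ᴱ Σᴱ (map (λ a → wFuel f (target a)) (arrowsFrom p))

w : Pair → Elt
w p = wFuel (suc (size (proj₂ p))) p

tauFuel : ℕ → ℕ → Pair → Elt
tauFuel r zero p = s p
tauFuel r (suc f) p =
  s p -ᴱ Σᴱ (map (λ a → tauFuel r f (target a)) (filterᵇ (satisfiesRowRule r p) (arrowsFrom p)))

τ : ℕ → Pair → Elt
τ r p = tauFuel r (suc (size (proj₂ p))) p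

{-# OPTIONS --safe #-}
module Submission where

-- Adjoin to the arrows an identity at every vertex (the empty tableau), so that s_p = Σ w_{t(a)}
-- over all arrows a from p. The claim then says that this sum factors: every arrow c : p → t is
-- uniquely a composite of an arrow a : p → q satisfying the row rule and an arrow b : q → t
-- satisfying the reverse row rule. Indeed a tableau T ∈ RW_{γ₁/α₁}(α₂/γ₂) amounts to a bijection
-- h from the boxes of α₂/γ₂ to those of γ₁/α₁ such that h and its inverse both turn rightward
-- steps into strictly-left, weakly-down ones and downward steps into strictly-down, weakly-left
-- ones (a picture in Zelevinsky's sense). These conditions force the boxes with R_r(x) ≤ row (h x)
-- to form an outer part α₂/β₂ of the source and an inner part β₁/α₁ of the target, which gives
-- q = (β₁ , β₂). Conversely, the row rules of a and b supply the conditions on neighbouring boxes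
-- on different sides of the cut when the two bijections are put together.

open import Defs
open import Data.Nat using (ℕ; zero; suc; _+_; _∸_; _⊓_; _≤_; _<_; z≤n; s≤s; s≤s⁻¹; _≤ᵇ_; _<ᵇ_; _≡ᵇ_)
open import Data.Nat.Properties
open import Data.Nat.ListAction using (sum)
open import Data.Integer as ℤ using (ℤ; 0ℤ)
import Data.Integer.Properties as ℤ
open import Algebra.Properties.CommutativeSemigroup +-commutativeSemigroup using (interchange)
open import Data.Bool using (Bool; true; false; T; if_then_else_; _∧_; _∨_; not)
open import Data.Bool.Properties using (T-∧)
open import Data.Unit using (tt)
open import Data.Empty using (⊥-elim)
open import Data.Fin using (Fin; zero; suc; toℕ; fromℕ<)
open import Data.Fin.Properties using (toℕ-fromℕ<; toℕ<n; toℕ-injective)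
open import Data.List using (List; []; _∷_; _++_; map; concatMap; foldr; length; lookup; zip; applyUpTo; upTo; reverse)
open import Data.List.Properties
  using (length-++; length-map; length-applyUpTo; reverse-applyUpTo; map-∘; map-id; map-cong-local;
         ∷-injective; ∷-injectiveˡ; ∷-injectiveʳ)
open import Data.List.Relation.Unary.Any using (here; there; index)
open import Data.List.Relation.Unary.Any.Properties using (lookup-index; reverse⁺; reverse⁻)
open import Data.List.Relation.Unary.All using ([]; _∷_)
import Data.List.Relation.Unary.All as All
import Data.List.Relation.Unary.All.Properties as All
open import Data.List.Relation.Unary.AllPairs using (AllPairs; []; _∷_)
import Data.List.Relation.Unary.AllPairs as AllPairs
import Data.List.Relation.Unary.AllPairs.Properties as AllPairs
open import Data.List.Relation.Unary.Unique.Propositional using (Unique)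
import Data.List.Relation.Unary.Unique.Propositional.Properties as Unique
open import Data.List.Membership.Propositional using (_∈_; _∉_; find; lose)
open import Data.List.Membership.Propositional.Properties
open import Data.List.Membership.Propositional.Properties.WithK using (unique∧set⇒bag)
open import Data.List.Relation.Binary.BagAndSetEquality using (∼bag⇒↭)
open import Data.List.Relation.Binary.Permutation.Propositional
  using (_↭_; ↭-refl; ↭-sym; ↭-trans; prep; swap; ↭⇒↭ₛ)
open import Data.List.Relation.Binary.Permutation.Propositional.Properties
  using (drop-mid; ∈-resp-↭; ↭-empty-inv; ↭-length) renaming (map⁺ to ↭-map⁺)
import Data.List.Relation.Binary.Permutation.Setoid.Properties as ↭ₛ
open import Data.Product using (_×_; _,_; proj₁; proj₂; ∃)
open import Data.Product.Properties using (≡-dec)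
open import Data.Sum using (_⊎_; inj₁; inj₂)
open import Function using (_∘_)
open import Function.Bundles using (Equivalence; mk⇔)
open import Relation.Nullary using (¬_; Dec; yes; no)
open import Relation.Nullary.Decidable using (¬?; _⊎-dec_; decidable-stable)
open import Relation.Binary.Definitions using (DecidableEquality; tri<; tri≈; tri>)
open import Relation.Binary.PropositionalEquality
  using (_≡_; _≢_; _≗_; refl; sym; trans; cong; cong₂; subst; subst₂; setoid; module ≡-Reasoning)

-- Let V_p be the sum of w_{t(b)} over the reverse arrows b from p, identity included
-- (`τ-candidate`). Factoring rewrites the expansion of s_p as the sum of V_{t(a)} over the row-rule
-- arrows a, identity included. This is the recursion that defines τ^r, so V = τ^r by induction on
-- |α₂|. Since sums count multiplicity, both index lists must be free of duplicates. The two factors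
-- live on disjoint sets of boxes, so composing them means gluing two maps, not applying one after
-- the other. The delicate point is a pair of neighbours on different sides of the cut. The row
-- rules speak of image rows only. For h they give the row half of the condition, and the column
-- half is forced by the nesting of the shapes. For the inverse of h they compare only the diagonals
-- of the preimages, and this becomes a comparison of rows once h is known to satisfy its own half.
-- The two halves are therefore not treated symmetrically.

private variable A B : Set

-- Lists

T-∧⁻ : ∀ x {y} → T (x ∧ y) → T x × T y
T-∧⁻ _ = Equivalence.to T-∧

T-∧⁺ : ∀ {x y} → T x → T y → T (x ∧ y)
T-∧⁺ p q = Equivalence.from T-∧ (p , q)

∈-filterᵇ⁻ : (p : A → Bool) (xs : List A) {x : A} → x ∈ filterᵇ p xs → x ∈ xs × T (p x)
∈-filterᵇ⁻ p (y ∷ xs) m with p y in eq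
∈-filterᵇ⁻ p (y ∷ xs) (here refl) | true = here refl , subst T (sym eq) tt
∈-filterᵇ⁻ p (y ∷ xs) (there m) | true = let (n , t) = ∈-filterᵇ⁻ p xs m in there n , t
∈-filterᵇ⁻ p (y ∷ xs) m | false = let (n , t) = ∈-filterᵇ⁻ p xs m in there n , t

∈-filterᵇ⁺ : (p : A → Bool) {xs : List A} {x : A} → x ∈ xs → T (p x) → x ∈ filterᵇ p xs
∈-filterᵇ⁺ p {y ∷ xs} m t with p y in eq
∈-filterᵇ⁺ p {y ∷ xs} (here refl) t | true = here refl
∈-filterᵇ⁺ p {y ∷ xs} (there m) t | true = there (∈-filterᵇ⁺ p m t)
∈-filterᵇ⁺ p {y ∷ xs} (here refl) t | false = ⊥-elim (subst T eq t)
∈-filterᵇ⁺ p {y ∷ xs} (there m) t | false = ∈-filterᵇ⁺ p m t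

Unique-filterᵇ⁺ : (p : A → Bool) {xs : List A} → Unique xs → Unique (filterᵇ p xs)
Unique-filterᵇ⁺ p {[]} [] = []
Unique-filterᵇ⁺ p {x ∷ xs} (x∉ ∷ u) with p x
... | true = All.tabulate (λ m → All.lookup x∉ (proj₁ (∈-filterᵇ⁻ p xs m))) ∷ Unique-filterᵇ⁺ p u
... | false = Unique-filterᵇ⁺ p u

allᵇ⁻ : (p : A → Bool) {xs : List A} → T (allᵇ p xs) → ∀ {x} → x ∈ xs → T (p x)
allᵇ⁻ p {y ∷ xs} t (here refl) = proj₁ (T-∧⁻ (p y) t)
allᵇ⁻ p {y ∷ xs} t (there m) = allᵇ⁻ p (proj₂ (T-∧⁻ (p y) t)) m

allᵇ⁺ : (p : A → Bool) (xs : List A) → (∀ x → x ∈ xs → T (p x)) → T (allᵇ p xs)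
allᵇ⁺ p [] h = tt
allᵇ⁺ p (x ∷ xs) h = T-∧⁺ (h x (here refl)) (allᵇ⁺ p xs (λ y m → h y (there m)))

∈-concatMap-intro : (f : A → List B) {xs : List A} {x : A} {y : B} → x ∈ xs → y ∈ f x → y ∈ concatMap f xs
∈-concatMap-intro f m n = ∈-concatMap⁺ f (lose m n)

∈-concatMap-elim : (f : A → List B) {xs : List A} {y : B} → y ∈ concatMap f xs → ∃ λ x → x ∈ xs × y ∈ f x
∈-concatMap-elim f m = find (∈-concatMap⁻ f m)

Unique-concatMap⁺ : (f : A → List B) {xs : List A} → Unique xs → (∀ {x} → x ∈ xs → Unique (f x)) →
  (∀ {x y z} → x ∈ xs → y ∈ xs → z ∈ f x → z ∈ f y → x ≡ y) → Unique (concatMap f xs)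
Unique-concatMap⁺ f {[]} [] u d = []
Unique-concatMap⁺ f {x ∷ xs} (x∉ ∷ v) u d = Unique.++⁺ (u (here refl))
  (Unique-concatMap⁺ f v (u ∘ there) (λ m n → d (there m) (there n)))
  λ { (m , n) → let (y , y∈ , z∈) = ∈-concatMap-elim f n in
                All.lookup x∉ y∈ (d (here refl) (there y∈) m z∈) }

-- `Unique.map⁺` asks for injectivity everywhere.
Unique-map⁺ : (f : A → B) {xs : List A} → Unique xs →
  (∀ {x y} → x ∈ xs → y ∈ xs → f x ≡ f y → x ≡ y) → Unique (map f xs)
Unique-map⁺ f {[]} [] inj = []
Unique-map⁺ f {x ∷ xs} (x∉ ∷ u) inj =
  All.tabulate (λ m e → let (y , y∈ , eq) = ∈-map⁻ f m in
                        All.lookup x∉ y∈ (inj (here refl) (there y∈) (trans e eq)))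
  ∷ Unique-map⁺ f u (λ m n → inj (there m) (there n))

∈-pairsOf⁺ : {xs : List A} {x y : A} → x ∈ xs → y ∈ xs → (x , y) ∈ pairsOf xs
∈-pairsOf⁺ {xs = xs} m n = ∈-concatMap-intro (λ x → map (x ,_) xs) m (∈-map⁺ _ n)

∈-pairsOf⁻ : (xs : List A) {x y : A} → (x , y) ∈ pairsOf xs → x ∈ xs × y ∈ xs
∈-pairsOf⁻ xs m with ∈-concatMap-elim (λ x → map (x ,_) xs) m
... | x , x∈ , n with ∈-map⁻ _ n
... | y , y∈ , refl = x∈ , y∈

∈-insertAll⁻ : {x : A} (ys : List A) {zs : List A} → zs ∈ insertAll x ys → zs ↭ x ∷ ys
∈-insertAll⁻ [] (here refl) = ↭-refl
∈-insertAll⁻ (y ∷ ys) (here refl) = ↭-refl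
∈-insertAll⁻ {x = x} (y ∷ ys) (there m) with ∈-map⁻ (y ∷_) m
... | ws , n , refl = ↭-trans (prep y (∈-insertAll⁻ ys n)) (swap y x ↭-refl)

∈-insertAll⁺ : {x : A} (us : List A) {vs : List A} → us ++ x ∷ vs ∈ insertAll x (us ++ vs)
∈-insertAll⁺ [] {[]} = here refl
∈-insertAll⁺ [] {v ∷ vs} = here refl
∈-insertAll⁺ (u ∷ us) = there (∈-map⁺ (u ∷_) (∈-insertAll⁺ us))

-- Deleting `x` from `zs` recovers `ys`, because `x` occurs only where it was inserted. This keeps
-- the blocks of `permutations` disjoint.
insertAll-injective : {x : A} {ys ys′ : List A} → x ∉ ys → x ∉ ys′ →
  ∀ {zs} → zs ∈ insertAll x ys → zs ∈ insertAll x ys′ → ys ≡ ys′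
insertAll-injective {ys = []} {[]} x∉ x∉′ m m′ = refl
insertAll-injective {ys = []} {y ∷ ys′} x∉ x∉′ (here refl) (here ())
insertAll-injective {ys = []} {y ∷ ys′} x∉ x∉′ (here refl) (there m′) with ∈-map⁻ (y ∷_) m′
... | _ , _ , refl = ⊥-elim (x∉′ (here refl))
insertAll-injective {ys = y ∷ ys} {[]} x∉ x∉′ (here refl) (here ())
insertAll-injective {ys = y ∷ ys} {[]} x∉ x∉′ (there m) (here refl) with ∈-map⁻ (y ∷_) m
... | _ , _ , refl = ⊥-elim (x∉ (here refl))
insertAll-injective {ys = y ∷ ys} {y′ ∷ ys′} x∉ x∉′ (here refl) (here refl) = refl
insertAll-injective {ys = y ∷ ys} {y′ ∷ ys′} x∉ x∉′ (here refl) (there m′) with ∈-map⁻ (y′ ∷_) m′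
... | _ , _ , refl = ⊥-elim (x∉′ (here refl))
insertAll-injective {ys = y ∷ ys} {y′ ∷ ys′} x∉ x∉′ (there m) (here refl) with ∈-map⁻ (y ∷_) m
... | _ , _ , refl = ⊥-elim (x∉ (here refl))
insertAll-injective {ys = y ∷ ys} {y′ ∷ ys′} x∉ x∉′ (there m) (there m′)
  with ∈-map⁻ (y ∷_) m | ∈-map⁻ (y′ ∷_) m′
... | _ , n , refl | _ , n′ , refl = cong (y ∷_) (insertAll-injective (x∉ ∘ there) (x∉′ ∘ there) n n′)

Unique-insertAll : {x : A} {ys : List A} → x ∉ ys → Unique (insertAll x ys)
Unique-insertAll {ys = []} x∉ = [] ∷ []
Unique-insertAll {ys = y ∷ ys} x∉ =
  All.tabulate (λ { m refl → let (_ , _ , e) = ∈-map⁻ (y ∷_) m in x∉ (here (∷-injectiveˡ e)) })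
  ∷ Unique.map⁺ ∷-injectiveʳ (Unique-insertAll (x∉ ∘ there))

∈-permutations⁻ : (xs : List A) {zs : List A} → zs ∈ permutations xs → zs ↭ xs
∈-permutations⁻ [] (here refl) = ↭-refl
∈-permutations⁻ (x ∷ xs) m with ∈-concatMap-elim (insertAll x) {permutations xs} m
... | ys , ys∈ , n = ↭-trans (∈-insertAll⁻ ys n) (prep x (∈-permutations⁻ xs ys∈))

∈-permutations⁺ : (xs : List A) {zs : List A} → zs ↭ xs → zs ∈ permutations xs
∈-permutations⁺ [] p rewrite ↭-empty-inv p = here refl
∈-permutations⁺ (x ∷ xs) p with ∈-∃++ (∈-resp-↭ (↭-sym p) (here refl))
... | us , vs , refl = ∈-concatMap-intro (insertAll x) (∈-permutations⁺ xs (drop-mid us [] p)) (∈-insertAll⁺ us)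

Unique-permutations : {xs : List A} → Unique xs → Unique (permutations xs)
Unique-permutations {xs = []} [] = [] ∷ []
Unique-permutations {xs = x ∷ xs} u@(_ ∷ v) = Unique-concatMap⁺ (insertAll x) (Unique-permutations v)
  (λ m → Unique-insertAll (x∉ m)) (λ m m′ → insertAll-injective (x∉ m) (x∉ m′))
  where
  x∉ : ∀ {ys} → ys ∈ permutations xs → x ∉ ys
  x∉ m n = Unique.Unique[x∷xs]⇒x∉xs u (∈-resp-↭ (∈-permutations⁻ xs m) n)

-- Labels

∈-zip⁻ : (f : ℕ → ℕ) (xs : List A) {i : ℕ} {x : A} → (i , x) ∈ zip (applyUpTo f (length xs)) xs →
  ∃ λ m → i ≡ f (toℕ m) × x ≡ lookup xs m
∈-zip⁻ f (x ∷ xs) (here refl) = zero , refl , refl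
∈-zip⁻ f (x ∷ xs) (there p) with ∈-zip⁻ (f ∘ suc) xs p
... | m , e , e′ = suc m , e , e′

∈-zip⁺ : (f : ℕ → ℕ) (xs : List A) (m : Fin (length xs)) →
  (f (toℕ m) , lookup xs m) ∈ zip (applyUpTo f (length xs)) xs
∈-zip⁺ f (x ∷ xs) zero = here refl
∈-zip⁺ f (x ∷ xs) (suc m) = there (∈-zip⁺ (f ∘ suc) xs m)

∈-labelled⁻ : (xs : List A) {i : ℕ} {x : A} → (i , x) ∈ labelled xs →
  ∃ λ m → i ≡ suc (toℕ m) × x ≡ lookup xs m
∈-labelled⁻ = ∈-zip⁻ suc

∈-labelled⁺ : (xs : List A) (m : Fin (length xs)) → (suc (toℕ m) , lookup xs m) ∈ labelled xs
∈-labelled⁺ = ∈-zip⁺ suc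

∈⇒labelled : {xs : List A} {x : A} → x ∈ xs → ∃ λ i → (i , x) ∈ labelled xs
∈⇒labelled {xs = xs} {x} x∈ =
  suc (toℕ (index x∈)) , subst (λ y → (suc (toℕ (index x∈)) , y) ∈ labelled xs) (sym (lookup-index x∈)) (∈-labelled⁺ xs (index x∈))

labelled⇒∈ : (xs : List A) {i : ℕ} {x : A} → (i , x) ∈ labelled xs → x ∈ xs
labelled⇒∈ xs p with ∈-labelled⁻ xs p
... | m , _ , refl = ∈-lookup {xs = xs} m

labelled-map : (h : A → B) (xs : List A) → labelled (map h xs) ≡ map (λ ix → proj₁ ix , h (proj₂ ix)) (labelled xs)
labelled-map h = go suc
  where
  go : ∀ (f : ℕ → ℕ) xs → zip (applyUpTo f (length (map h xs))) (map h xs)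
                          ≡ map (λ ix → proj₁ ix , h (proj₂ ix)) (zip (applyUpTo f (length xs)) xs)
  go f [] = refl
  go f (x ∷ xs) = cong (_ ∷_) (go (f ∘ suc) xs)

posOf-map : (h : A → Box) (xs : List A) {i : ℕ} {x : A} → (i , x) ∈ labelled xs → posOf (map h xs) i ≡ h x
posOf-map h xs p with ∈-labelled⁻ xs p
... | m , refl , refl = go xs m
  where
  go : ∀ xs m → posOf (map h xs) (suc (toℕ m)) ≡ h (lookup xs m)
  go (x ∷ xs) zero = refl
  go (x ∷ xs) (suc m) = go xs m

labelled-increasing : {R : A → A → Set} {xs : List A} → AllPairs R xs →
  ∀ {i j x y} → (i , x) ∈ labelled xs → (j , y) ∈ labelled xs → i < j → R x y
labelled-increasing {R = R} {xs} r p q i<j with ∈-labelled⁻ xs p | ∈-labelled⁻ xs q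
... | m , refl , refl | n , refl , refl = go r m n (s≤s⁻¹ i<j)
  where
  go : ∀ {xs} → AllPairs R xs → ∀ m n → toℕ m < toℕ n → R (lookup xs m) (lookup xs n)
  go (r ∷ rs) zero (suc n) _ = All.lookup r (∈-lookup n)
  go (r ∷ rs) (suc m) (suc n) m<n = go rs m n (s≤s⁻¹ m<n)

labelled-functional : (xs : List A) {i : ℕ} {x y : A} → (i , x) ∈ labelled xs → (i , y) ∈ labelled xs → x ≡ y
labelled-functional xs p q with ∈-labelled⁻ xs p | ∈-labelled⁻ xs q
... | m , refl , refl | n , e , refl = cong (lookup xs) (toℕ-injective (suc-injective e))

labelled-between : (xs : List A) {i j : ℕ} {x y : A} → (i , x) ∈ labelled xs → (j , y) ∈ labelled xs → i < j →
  ∃ λ z → (suc i , z) ∈ labelled xs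
labelled-between xs p q i<j with ∈-labelled⁻ xs p | ∈-labelled⁻ xs q
... | m , refl , refl | n , refl , refl = _ ,
  subst (λ k → (suc k , lookup xs (fromℕ< l)) ∈ labelled xs) (toℕ-fromℕ< l) (∈-labelled⁺ xs (fromℕ< l))
  where
  l : suc (toℕ m) < length xs
  l = ≤-trans i<j (toℕ<n n)

-- Partitions

-- The bound on the parts lets inductions pass to the tail, which is bounded by the part removed.
-- Positivity of the parts excludes trailing zeros, so that the row lengths determine the list.
data PartitionBelow (m : ℕ) : List ℕ → Set where
  [] : PartitionBelow m []
  cons : ∀ {x xs} → 1 ≤ x → x ≤ m → PartitionBelow x xs → PartitionBelow m (x ∷ xs)

IsPartition : Partition → Set
IsPartition α = ∃ λ m → PartitionBelow m α

below-tighten : ∀ {m m′ xs} → PartitionBelow m xs → at xs 0 ≤ m′ → PartitionBelow m′ xs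
below-tighten [] _ = []
below-tighten (cons p _ q) l = cons p l q

isPartition⁻ : ∀ xs → T (isPartition xs) → IsPartition xs
isPartition⁻ [] t = 0 , []
isPartition⁻ (x ∷ xs) t = x , proj₂ (go x xs t ≤-refl)
  where
  go : ∀ {m} x xs → T (isPartition (x ∷ xs)) → x ≤ m → 1 ≤ x × PartitionBelow m (x ∷ xs)
  go x [] t l = ≤ᵇ⇒≤ 1 x t , cons (≤ᵇ⇒≤ 1 x t) l []
  go x (y ∷ xs) t l with T-∧⁻ (y ≤ᵇ x) t
  ... | y≤x , t′ with go y xs t′ (≤ᵇ⇒≤ y x y≤x)
  ... | 1≤y , r = ≤-trans 1≤y (≤ᵇ⇒≤ y x y≤x) , cons (≤-trans 1≤y (≤ᵇ⇒≤ y x y≤x)) l r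

∈-partsBounded⁻ : ∀ f n m {xs} → xs ∈ partsBounded f n m → PartitionBelow m xs × sum xs ≡ n
∈-partsBounded⁻ zero zero m (here refl) = [] , refl
∈-partsBounded⁻ (suc f) zero m (here refl) = [] , refl
∈-partsBounded⁻ (suc f) (suc n) m p
  with ∈-concatMap-elim (λ j → map (j ∷_) (partsBounded f (suc n ∸ j) j)) {applyUpTo suc (m ⊓ suc n)} p
... | j , j∈ , q with ∈-applyUpTo⁻ suc j∈ | ∈-map⁻ (j ∷_) q
... | k , k< , refl | ys , ys∈ , refl with ∈-partsBounded⁻ f (n ∸ k) (suc k) ys∈
... | b , e = cons (s≤s z≤n) (≤-trans k< (m⊓n≤m m (suc n))) b ,
  trans (cong (suc k +_) e) (cong suc (m+[n∸m]≡n (s≤s⁻¹ (≤-trans k< (m⊓n≤n m (suc n))))))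

∈-partsBounded⁺ : ∀ f n m {xs} → n ≤ f → PartitionBelow m xs → sum xs ≡ n → xs ∈ partsBounded f n m
∈-partsBounded⁺ zero zero m n≤f [] e = here refl
∈-partsBounded⁺ (suc f) zero m n≤f [] e = here refl
∈-partsBounded⁺ zero zero m n≤f (cons (s≤s p) x≤m b) ()
∈-partsBounded⁺ (suc f) zero m n≤f (cons (s≤s p) x≤m b) ()
∈-partsBounded⁺ (suc f) (suc n) m n≤f [] ()
∈-partsBounded⁺ (suc f) (suc n) m n≤f (cons {suc k} {xs} p x≤m b) e =
  ∈-concatMap-intro (λ j → map (j ∷_) (partsBounded f (suc n ∸ j) j))
    (∈-applyUpTo⁺ suc (⊓-glb x≤m (≤-trans (m≤m+n (suc k) (sum xs)) (≤-reflexive e))))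
    (∈-map⁺ (suc k ∷_) (∈-partsBounded⁺ f (n ∸ k) (suc k) (≤-trans (m∸n≤m n k) (s≤s⁻¹ n≤f)) b
      (sym (trans (cong (_∸ k) (sym (suc-injective e))) (m+n∸m≡n k (sum xs))))))

Unique-applyUpTo-suc : ∀ n → Unique (applyUpTo suc n)
Unique-applyUpTo-suc n = Unique.applyUpTo⁺₁ suc n (λ i<j _ e → <⇒≢ i<j (suc-injective e))

Unique-partsBounded : ∀ f n m → Unique (partsBounded f n m)
Unique-partsBounded zero zero m = [] ∷ []
Unique-partsBounded (suc f) zero m = [] ∷ []
Unique-partsBounded zero (suc n) m = []
Unique-partsBounded (suc f) (suc n) m = Unique-concatMap⁺ (λ j → map (j ∷_) (partsBounded f (suc n ∸ j) j))
  (Unique-applyUpTo-suc (m ⊓ suc n))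
  (λ {j} _ → Unique.map⁺ ∷-injectiveʳ (Unique-partsBounded f (suc n ∸ j) j))
  (λ {j} {j′} _ _ p q → let (_ , _ , e) = ∈-map⁻ (j ∷_) p ; (_ , _ , e′) = ∈-map⁻ (j′ ∷_) q in
     ∷-injectiveˡ (trans (sym e) e′))

part≤sum : ∀ xs → at xs 0 ≤ sum xs
part≤sum [] = z≤n
part≤sum (x ∷ xs) = m≤m+n x (sum xs)

∈-partitionsOf⁻ : ∀ n {xs} → xs ∈ partitionsOf n → IsPartition xs × sum xs ≡ n
∈-partitionsOf⁻ n p = let (b , e) = ∈-partsBounded⁻ n n n p in (n , b) , e

∈-partitionsOf⁺ : ∀ {n xs} → IsPartition xs → sum xs ≡ n → xs ∈ partitionsOf n
∈-partitionsOf⁺ {n} {xs} (_ , b) refl = ∈-partsBounded⁺ n n n ≤-refl (below-tighten b (part≤sum xs)) refl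

-- `at` counts rows from 0 and reads missing rows as 0, whereas boxes count rows from 1. Row `i`
-- here is therefore row `suc i` of a box.
_⊑_ : Partition → Partition → Set
β ⊑ α = ∀ i → at β i ≤ at α i

⊆ᵇ⇒⊑ : ∀ β α → T (β ⊆ᵇ α) → β ⊑ α
⊆ᵇ⇒⊑ [] α t i = z≤n
⊆ᵇ⇒⊑ (b ∷ bs) (a ∷ as) t zero = ≤ᵇ⇒≤ b a (proj₁ (T-∧⁻ (b ≤ᵇ a) t))
⊆ᵇ⇒⊑ (b ∷ bs) (a ∷ as) t (suc i) = ⊆ᵇ⇒⊑ bs as (proj₂ (T-∧⁻ (b ≤ᵇ a) t)) i

⊑⇒⊆ᵇ : ∀ {m β} α → PartitionBelow m β → β ⊑ α → T (β ⊆ᵇ α)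
⊑⇒⊆ᵇ α [] l = tt
⊑⇒⊆ᵇ [] (cons p _ _) l = ⊥-elim (<⇒≱ p (l 0))
⊑⇒⊆ᵇ (a ∷ as) (cons p _ b) l = T-∧⁺ (≤⇒≤ᵇ (l 0)) (⊑⇒⊆ᵇ as b (l ∘ suc))

⊑-antisym : ∀ {m m′ β α} → PartitionBelow m β → PartitionBelow m′ α → β ⊑ α → α ⊑ β → β ≡ α
⊑-antisym [] [] l g = refl
⊑-antisym [] (cons p _ _) l g = ⊥-elim (<⇒≱ p (g 0))
⊑-antisym (cons p _ _) [] l g = ⊥-elim (<⇒≱ p (l 0))
⊑-antisym (cons _ _ b) (cons _ _ b′) l g =
  cong₂ _∷_ (≤-antisym (l 0) (g 0)) (⊑-antisym b b′ (l ∘ suc) (g ∘ suc))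

below-at : ∀ {m xs} → PartitionBelow m xs → ∀ i → at xs i ≤ m
below-at [] i = z≤n
below-at (cons _ q b) zero = q
below-at (cons _ q b) (suc i) = ≤-trans (below-at b i) q

at-antitone : ∀ {xs} → IsPartition xs → ∀ {i j} → i ≤ j → at xs j ≤ at xs i
at-antitone (_ , []) {i} {j} _ = z≤n
at-antitone (_ , cons p q b) {zero} {zero} _ = ≤-refl
at-antitone (_ , cons p q b) {zero} {suc j} _ = below-at b j
at-antitone (_ , cons p q b) {suc i} {suc j} l = at-antitone (_ , b) (s≤s⁻¹ l)

⊑⇒sum≤ : ∀ {β α} → T (β ⊆ᵇ α) → sum β ≤ sum α
⊑⇒sum≤ {[]} t = z≤n
⊑⇒sum≤ {b ∷ bs} {a ∷ as} t with T-∧⁻ (b ≤ᵇ a) t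
... | p , q = +-mono-≤ (≤ᵇ⇒≤ b a p) (⊑⇒sum≤ {bs} {as} q)

∈-subPartitions⁻ : ∀ {α β} → β ∈ subPartitions α → IsPartition β × T (β ⊆ᵇ α)
∈-subPartitions⁻ {α} p with ∈-filterᵇ⁻ (λ β → β ⊆ᵇ α) _ p
... | q , t with ∈-concatMap-elim partitionsOf {upTo (suc (size α))} q
... | n , _ , m = proj₁ (∈-partitionsOf⁻ n m) , t

∈-subPartitions⁺ : ∀ {α β} → IsPartition β → T (β ⊆ᵇ α) → β ∈ subPartitions α
∈-subPartitions⁺ {α} {β} p t = ∈-filterᵇ⁺ (λ β → β ⊆ᵇ α)
  (∈-concatMap-intro partitionsOf (∈-upTo⁺ (s≤s (⊑⇒sum≤ {β} {α} t))) (∈-partitionsOf⁺ p refl)) t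

Unique-subPartitions : ∀ α → Unique (subPartitions α)
Unique-subPartitions α = Unique-filterᵇ⁺ (λ β → β ⊆ᵇ α) (Unique-concatMap⁺ partitionsOf (Unique.upTo⁺ (suc (size α)))
  (λ {n} _ → Unique-partsBounded n n n)
  (λ {n} {n′} _ _ p q → trans (sym (proj₂ (∈-partitionsOf⁻ n p))) (proj₂ (∈-partitionsOf⁻ n′ q))))

-- Order ideals of boxes

-- Supplies a single row of `ideal-partition`: a set of columns closed to the left is determined by
-- its length.
prefix : (P : ℕ → Set) → (∀ c → Dec (P c)) → ∀ n → (∀ c → 1 ≤ c → suc c ≤ n → P (suc c) → P c) →
  ∃ λ b → b ≤ n × (∀ c → 1 ≤ c → c ≤ b → P c) × (∀ c → 1 ≤ c → c ≤ n → P c → c ≤ b)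
prefix P P? zero down = 0 , z≤n , (λ c p q → ⊥-elim (<⇒≱ p q)) , λ c _ q _ → q
prefix P P? (suc n) down with P? (suc n)
... | yes Pn = suc n , ≤-refl , (λ c p q → go (suc n) c p q ≤-refl Pn) , λ c _ q _ → q
  where
  go : ∀ k c → 1 ≤ c → c ≤ k → k ≤ suc n → P k → P c
  go zero c p q l Pk = ⊥-elim (<⇒≱ p q)
  go (suc k) c p q l Pk with m≤n⇒m<n∨m≡n q
  ... | inj₂ refl = Pk
  ... | inj₁ c<sk = go k c p (s≤s⁻¹ c<sk) (≤-trans (n≤1+n k) l) (down k (≤-trans p (s≤s⁻¹ c<sk)) l Pk)
... | no ¬Pn with prefix P P? n (λ c p q → down c p (m≤n⇒m≤1+n q))
... | b , b≤ , f , g = b , m≤n⇒m≤1+n b≤ , f , h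
  where
  h : ∀ c → 1 ≤ c → c ≤ suc n → P c → c ≤ b
  h c p q Pc with m≤n⇒m<n∨m≡n q
  ... | inj₂ refl = ⊥-elim (¬Pn Pc)
  ... | inj₁ c<sn = g c p (s≤s⁻¹ c<sn) Pc

-- Closure to the left makes each row of `D` inside `α` an initial segment, and closure upwards
-- makes the lengths of these segments weakly decreasing. `D` counts rows from 0 and columns from 1.
ideal-partition : ∀ {m α} → PartitionBelow m α → (D : ℕ → ℕ → Set) → (∀ i c → Dec (D i c)) →
  (∀ i c → 1 ≤ c → suc c ≤ at α i → D i (suc c) → D i c) →
  (∀ i c → 1 ≤ c → c ≤ at α (suc i) → D (suc i) c → D i c) →
  ∃ λ β → PartitionBelow m β ×
    (∀ i c → 1 ≤ c → c ≤ at β i → c ≤ at α i × D i c) ×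
    (∀ i c → 1 ≤ c → c ≤ at α i → D i c → c ≤ at β i)
ideal-partition [] D D? left up = [] , [] , (λ i c p q → ⊥-elim (<⇒≱ p q)) , λ i c p q _ → q
ideal-partition {α = a ∷ as} (cons 1≤a a≤m b) D D? left up
  with prefix (D 0) (D? 0) a (left 0)
     | ideal-partition b (D ∘ suc) (D? ∘ suc) (left ∘ suc) (up ∘ suc)
-- Zero parts are not allowed, so an empty row ends the partition; closure upwards shows that
-- nothing is lost below it.
... | zero , n≤a , f , g | _ = [] , [] , (λ i c p q → ⊥-elim (<⇒≱ p q)) , λ i c p q d → top i c p q d
  where
  top : ∀ i c → 1 ≤ c → c ≤ at (a ∷ as) i → D i c → c ≤ 0
  top zero c p q d = g c p q d
  top (suc i) c p q d = top i c p (≤-trans q (at-antitone (_ , cons 1≤a a≤m b) (n≤1+n i))) (up i c p q d)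
... | suc n , n≤a , f , g | β , bβ , F , G = suc n ∷ β , cons (s≤s z≤n) (≤-trans n≤a a≤m) (below-tighten bβ head) , F′ , G′
  where
  head : at β 0 ≤ suc n
  head with at β 0 in eq
  ... | zero = z≤n
  ... | suc c with F 0 (suc c) (s≤s z≤n) (≤-reflexive (sym eq))
  ... | q , d = g (suc c) (s≤s z≤n) (≤-trans q (below-at b 0)) (up 0 (suc c) (s≤s z≤n) q d)
  F′ : ∀ i c → 1 ≤ c → c ≤ at (suc n ∷ β) i → c ≤ at (a ∷ as) i × D i c
  F′ zero c p q = ≤-trans q n≤a , f c p q
  F′ (suc i) = F i
  G′ : ∀ i c → 1 ≤ c → c ≤ at (a ∷ as) i → D i c → c ≤ at (suc n ∷ β) i
  G′ zero = g
  G′ (suc i) = G i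

-- Bijections of boxes and of arrows are used as permutations of lists. Without duplicates, this
-- reduces to having the same members.
unique-set⇒↭ : {xs ys : List A} → Unique xs → Unique ys →
  (∀ {x} → x ∈ xs → x ∈ ys) → (∀ {x} → x ∈ ys → x ∈ xs) → xs ↭ ys
unique-set⇒↭ u v f g = ∼bag⇒↭ (unique∧set⇒bag u v (mk⇔ f g))

-- Boxes of skew shapes and their reading order

row col : Box → ℕ
row = proj₁
col = proj₂

InSkew : Partition → Partition → Box → Set
InSkew α β x = 1 ≤ row x × rowLen β (row x) < col x × col x ≤ rowLen α (row x)

inSkew? : ∀ α β x → Dec (InSkew α β x)
inSkew? α β (i , c) with 1 ≤? i | suc (rowLen β i) ≤? c | c ≤? rowLen α i
... | yes p | yes q | yes r = yes (p , q , r)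
... | no ¬p | _ | _ = no (λ (p , _ , _) → ¬p p)
... | yes _ | no ¬q | _ = no (λ (_ , q , _) → ¬q q)
... | yes _ | yes _ | no ¬r = no (λ (_ , _ , r) → ¬r r)

0<at⇒<length : ∀ xs k → 0 < at xs k → k < length xs
0<at⇒<length (x ∷ xs) zero p = s≤s z≤n
0<at⇒<length (x ∷ xs) (suc k) p = s≤s (0<at⇒<length xs k p)

∈-skewRow⁻ : ∀ α β i {c} → c ∈ skewRow α β i → rowLen β i < c × c ≤ rowLen α i
∈-skewRow⁻ α β i p with ∈-applyUpTo⁻ (λ t → suc (rowLen β i + t)) p
... | t , t< , refl = s≤s (m≤m+n _ t) , subst (_≤ rowLen α i) (+-suc (rowLen β i) t)
  (≤-trans (+-monoʳ-≤ (rowLen β i) t<) (≤-reflexive (m+[n∸m]≡n (<⇒≤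
    (m∸n≢0⇒n<m {rowLen α i} {rowLen β i} (λ e → <⇒≱ t< (≤-trans (≤-reflexive e) z≤n)))))))

∈-skewRow⁺ : ∀ α β i {c} → rowLen β i < c → c ≤ rowLen α i → c ∈ skewRow α β i
∈-skewRow⁺ α β i {suc c} (s≤s p) q = subst (_∈ skewRow α β i) (cong suc (m+[n∸m]≡n p))
  (∈-applyUpTo⁺ (λ t → suc (rowLen β i + t)) (∸-monoˡ-< q p))

∈-rows⁻ : (f : ℕ → List ℕ) (n : ℕ) {x : Box} →
  x ∈ concatMap (λ i → map (λ c → i , c) (f i)) (applyUpTo suc n) →
  1 ≤ row x × row x ≤ n × col x ∈ f (row x)
∈-rows⁻ f n p with ∈-concatMap-elim (λ i → map (λ c → i , c) (f i)) {applyUpTo suc n} p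
... | i , i∈ , q with ∈-applyUpTo⁻ suc i∈ | ∈-map⁻ _ q
... | k , k< , refl | c , c∈ , refl = s≤s z≤n , k< , c∈

∈-rows⁺ : (f : ℕ → List ℕ) (n : ℕ) {x : Box} → 1 ≤ row x → row x ≤ n → col x ∈ f (row x) →
  x ∈ concatMap (λ i → map (λ c → i , c) (f i)) (applyUpTo suc n)
∈-rows⁺ f n {suc k , c} p k< q = ∈-concatMap-intro (λ i → map (λ c → i , c) (f i)) (∈-applyUpTo⁺ suc k<) (∈-map⁺ _ q)

inSkew⇒row≤ : ∀ {α β x} → InSkew α β x → row x ≤ length α
inSkew⇒row≤ {α} {x = suc k , c} (_ , p , q) = 0<at⇒<length α k (≤-trans (s≤s z≤n) (≤-trans p q))

∈-skewBoxes⁻ : ∀ α β {x} → x ∈ skewBoxes α β → InSkew α β x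
∈-skewBoxes⁻ α β {i , c} p with ∈-rows⁻ (skewRow α β) (length α) p
... | p , _ , q = p , ∈-skewRow⁻ α β i q

∈-skewBoxes⁺ : ∀ α β {x} → InSkew α β x → x ∈ skewBoxes α β
∈-skewBoxes⁺ α β {x} s@(p , q , r) = ∈-rows⁺ (skewRow α β) (length α) p (inSkew⇒row≤ {α} {β} s) (∈-skewRow⁺ α β (row x) q r)

∈-rlBoxes⁻ : ∀ α β {x} → x ∈ rlBoxes α β → InSkew α β x
∈-rlBoxes⁻ α β {i , c} p with ∈-rows⁻ (λ i → reverse (skewRow α β i)) (length α) p
... | p , _ , q = p , ∈-skewRow⁻ α β i (reverse⁻ q)

∈-rlBoxes⁺ : ∀ α β {x} → InSkew α β x → x ∈ rlBoxes α β
∈-rlBoxes⁺ α β {x} s@(p , q , r) = ∈-rows⁺ (λ i → reverse (skewRow α β i)) (length α) p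
  (inSkew⇒row≤ {α} {β} s) (reverse⁺ (∈-skewRow⁺ α β (row x) q r))

-- The reading order of rl(α/β).
_≺_ : Box → Box → Set
x ≺ y = row x < row y ⊎ row x ≡ row y × col y < col x

≺-asym : ∀ {x y} → x ≺ y → ¬ (y ≺ x)
≺-asym (inj₁ p) (inj₁ q) = <-asym p q
≺-asym (inj₁ p) (inj₂ (e , _)) = <-irrefl (sym e) p
≺-asym (inj₂ (e , _)) (inj₁ q) = <-irrefl (sym e) q
≺-asym (inj₂ (_ , p)) (inj₂ (_ , q)) = <-asym p q

≺-irrefl : ∀ {x y} → x ≡ y → ¬ (x ≺ y)
≺-irrefl refl p = ≺-asym p p

rlBoxes-sorted : ∀ α β → AllPairs _≺_ (rlBoxes α β)
rlBoxes-sorted α β = AllPairs.concat⁺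
  (All.map⁺ (All.applyUpTo⁺₂ suc (length α) λ i → AllPairs.map⁺ (inRow (suc i))))
  (AllPairs.map⁺ (AllPairs.applyUpTo⁺₁ suc (length α) λ i<j _ →
    All.map⁺ (All.tabulate λ _ → All.map⁺ (All.tabulate λ _ → inj₁ (s≤s i<j)))))
  where
  inRow : ∀ i → AllPairs (λ c d → (i , c) ≺ (i , d)) (reverse (skewRow α β i))
  inRow i = subst (AllPairs _) (sym (reverse-applyUpTo (λ t → suc (rowLen β i + t)) (rowLen α i ∸ rowLen β i)))
    (AllPairs.applyDownFrom⁺₁ (λ t → suc (rowLen β i + t)) _ λ j<k _ → inj₂ (refl , s≤s (+-monoʳ-< (rowLen β i) j<k)))

Unique-rlBoxes : ∀ α β → Unique (rlBoxes α β)
Unique-rlBoxes α β = AllPairs.map (λ x≺y e → ≺-irrefl e x≺y) (rlBoxes-sorted α β)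

Unique-skewBoxes : ∀ α β → Unique (skewBoxes α β)
Unique-skewBoxes α β = Unique-concatMap⁺ (λ i → map (λ c → i , c) (skewRow α β i)) (Unique-applyUpTo-suc (length α))
  (λ {i} _ → Unique.map⁺ (cong proj₂) (Unique.applyUpTo⁺₁ (λ t → suc (rowLen β i + t)) _
     (λ i<j _ e → <⇒≢ i<j (+-cancelˡ-≡ (rowLen β i) _ _ (suc-injective e)))))
  (λ {i} {j} _ _ p q → let (_ , _ , e) = ∈-map⁻ _ p ; (_ , _ , e′) = ∈-map⁻ _ q in
     cong proj₁ (trans (sym e) e′))

rlBoxes↭skewBoxes : ∀ α β → rlBoxes α β ↭ skewBoxes α β
rlBoxes↭skewBoxes α β = unique-set⇒↭ (Unique-rlBoxes α β) (Unique-skewBoxes α β)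
  (λ p → ∈-skewBoxes⁺ α β (∈-rlBoxes⁻ α β p)) (λ p → ∈-rlBoxes⁺ α β (∈-skewBoxes⁻ α β p))

length-skewBoxes : ∀ {α β} → T (β ⊆ᵇ α) → length (skewBoxes α β) + sum β ≡ sum α
length-skewBoxes {α} {β} t = trans (cong (_+ sum β) (rows suc (length α))) (go α β t)
  where
  rows : ∀ f n → length (concatMap (λ i → map (λ c → i , c) (skewRow α β i)) (applyUpTo f n))
                 ≡ sum (applyUpTo (λ k → rowLen α (f k) ∸ rowLen β (f k)) n)
  rows f zero = refl
  rows f (suc n) = trans (length-++ (map (λ c → f 0 , c) (skewRow α β (f 0))))
    (cong₂ _+_ (trans (length-map _ (skewRow α β (f 0))) (length-applyUpTo _ (rowLen α (f 0) ∸ rowLen β (f 0)))) (rows (f ∘ suc) n))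
  go : ∀ α β → T (β ⊆ᵇ α) → sum (applyUpTo (λ k → at α k ∸ at β k) (length α)) + sum β ≡ sum α
  go [] [] t = refl
  go (a ∷ as) [] t = trans (+-assoc a _ 0) (cong (a +_) (go as [] _))
  go (a ∷ as) (b ∷ bs) t with T-∧⁻ (b ≤ᵇ a) t
  ... | p , q = let S = sum (applyUpTo (λ k → at as k ∸ at bs k) (length as)) in
    trans (interchange (a ∸ b) S b (sum bs)) (cong₂ _+_ (m∸n+n≡m (≤ᵇ⇒≤ b a p)) (go as bs q))

-- Pictures

-- Closure under intervals of the componentwise order, so that a path of unit steps right and down
-- between two boxes stays in the shape.
Convex : (Box → Set) → Set
Convex A = ∀ {x z} → A x → A z → ∀ {y} → row x ≤ row y → row y ≤ row z → col x ≤ col y → col y ≤ col z → A y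

rowLen-antitone : ∀ {α} → IsPartition α → ∀ {i j} → i ≤ j → rowLen α j ≤ rowLen α i
rowLen-antitone p i≤j = at-antitone p (∸-monoˡ-≤ 1 i≤j)

inSkew-convex : ∀ {α β} → IsPartition α → IsPartition β → Convex (InSkew α β)
inSkew-convex pα pβ (1≤ , β< , _) (_ , _ , ≤α) r r′ c c′ =
  ≤-trans 1≤ r ,
  ≤-trans (s≤s (rowLen-antitone pβ r)) (≤-trans β< c) ,
  ≤-trans c′ (≤-trans ≤α (rowLen-antitone pα r′))

-- Asks only for unit steps, so that after gluing just the neighbours have to be examined. Convexity
-- extends the condition to all comparable boxes in `twist`.
record Twisting (A : Box → Set) (h : Box → Box) : Set where
  field
    right : ∀ {i c} → A (i , c) → A (i , suc c) →
      col (h (i , suc c)) < col (h (i , c)) × row (h (i , c)) ≤ row (h (i , suc c))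
    down : ∀ {i c} → A (i , c) → A (suc i , c) →
      row (h (i , c)) < row (h (suc i , c)) × col (h (suc i , c)) ≤ col (h (i , c))

module _ {A : Box → Set} {h : Box → Box} (convex : Convex A) (tw : Twisting A h) where
  open Twisting tw

  twist-row : ∀ {i c} d → A (i , c) → A (i , d + c) →
    d + col (h (i , d + c)) ≤ col (h (i , c)) × row (h (i , c)) ≤ row (h (i , d + c))
  twist-row zero a b = ≤-refl , ≤-refl
  twist-row {i} {c} (suc d) a b =
    let b′ = convex a b ≤-refl ≤-refl (m≤n+m c d) (n≤1+n (d + c))
        (p , q) = twist-row d a b′
        (p′ , q′) = right b′ b
    in ≤-trans (≤-trans (≤-reflexive (sym (+-suc d _))) (+-monoʳ-≤ d p′)) p , ≤-trans q q′

  twist-column : ∀ {i c} d → A (i , c) → A (d + i , c) →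
    d + row (h (i , c)) ≤ row (h (d + i , c)) × col (h (d + i , c)) ≤ col (h (i , c))
  twist-column zero a b = ≤-refl , ≤-refl
  twist-column {i} {c} (suc d) a b =
    let b′ = convex a b (m≤n+m i d) (n≤1+n (d + i)) ≤-refl ≤-refl
        (p , q) = twist-column d a b′
        (p′ , q′) = down b′ b
    in ≤-trans (s≤s p) p′ , ≤-trans q′ q

  -- Walk right to the column of `y`, then down to its row; convexity puts the corner in `A`. A step
  -- right costs at least one column and never decreases the row, and a step down gains at least one
  -- row and never increases the column.
  twist : ∀ {x y} → A x → A y → row x ≤ row y → col x ≤ col y →
    (row y ∸ row x) + row (h x) ≤ row (h y) × (col y ∸ col x) + col (h y) ≤ col (h x)
  twist {i , c} {j , d} a b i≤j c≤d =
    let (p , q) = twist-row (d ∸ c) a (subst (λ e → A (i , e)) (sym (m∸n+n≡m c≤d)) m)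
        (p′ , q′) = twist-column (j ∸ i) m (subst (λ k → A (k , d)) (sym (m∸n+n≡m i≤j)) b)
        p₁ = subst (λ e → (d ∸ c) + col (h (i , e)) ≤ col (h (i , c))) (m∸n+n≡m c≤d) p
        q₁ = subst (λ e → row (h (i , c)) ≤ row (h (i , e))) (m∸n+n≡m c≤d) q
        p₂ = subst (λ k → (j ∸ i) + row (h (i , d)) ≤ row (h (k , d))) (m∸n+n≡m i≤j) p′
        q₂ = subst (λ k → col (h (k , d)) ≤ col (h (i , d))) (m∸n+n≡m i≤j) q′
    in ≤-trans (+-monoʳ-≤ (j ∸ i) q₁) p₂ , ≤-trans (+-monoʳ-≤ (d ∸ c) q₂) p₁
    where
    m : A (i , d)
    m = convex a b ≤-refl i≤j c≤d ≤-refl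

  twist-row≤ : ∀ {x y} → A x → A y → row x ≤ row y → col x ≤ col y → row (h x) ≤ row (h y)
  twist-row≤ a b p q = ≤-trans (m≤n+m _ _) (proj₁ (twist a b p q))

  twist-row< : ∀ {x y} → A x → A y → row x < row y → col x ≤ col y → row (h x) < row (h y)
  twist-row< {x} a b p q = ≤-trans (+-monoˡ-≤ (row (h x)) (m<n⇒0<n∸m p)) (proj₁ (twist a b (<⇒≤ p) q))

  twist-col< : ∀ {x y} → A x → A y → row x ≤ row y → col x < col y → col (h y) < col (h x)
  twist-col< {x} {y} a b p q = ≤-trans (+-monoˡ-≤ (col (h y)) (m<n⇒0<n∸m q)) (proj₂ (twist a b p (<⇒≤ q)))

-- Both maps are total on boxes but constrained only on `A` and `B`, which lets a picture be
-- restricted to smaller shapes without changing its maps.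
record Picture (A B : Box → Set) (h g : Box → Box) : Set where
  field
    to : ∀ {x} → A x → B (h x)
    from : ∀ {y} → B y → A (g y)
    g∘h : ∀ {x} → A x → g (h x) ≡ x
    h∘g : ∀ {y} → B y → h (g y) ≡ y
    h-twists : Twisting A h
    g-twists : Twisting B g

-- If g (i , c) and g (i , suc c) were weakly north-west of each other in that order, h would
-- move strictly down between them, but their images share a row; similarly for columns.
inverse-twists : ∀ {A B h g} → Convex A → Twisting A h → (∀ {y} → B y → A (g y)) → (∀ {y} → B y → h (g y) ≡ y) →
  (∀ {i c} → B (i , c) → B (i , suc c) → g (i , c) ≺ g (i , suc c)) →
  (∀ {i c} → B (i , c) → B (suc i , c) → g (i , c) ≺ g (suc i , c)) → Twisting B g
inverse-twists {A} {B} {h} {g} convex tw from h∘g rows cols = record { right = R ; down = D }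
  where
  R : ∀ {i c} → B (i , c) → B (i , suc c) →
      col (g (i , suc c)) < col (g (i , c)) × row (g (i , c)) ≤ row (g (i , suc c))
  R {i} {c} b b′ with rows b b′
  ... | inj₂ (e , l) = l , ≤-reflexive e
  ... | inj₁ l = ≰⇒> (λ q → <-irrefl refl (subst₂ (λ y y′ → row y < row y′) (h∘g b) (h∘g b′)
                   (twist-row< convex tw (from b) (from b′) l q))) , <⇒≤ l
  D : ∀ {i c} → B (i , c) → B (suc i , c) →
      row (g (i , c)) < row (g (suc i , c)) × col (g (suc i , c)) ≤ col (g (i , c))
  D {i} {c} b b′ with cols b b′
  ... | inj₁ l = l , ≮⇒≥ (λ q → <-irrefl refl (subst₂ (λ y y′ → col y < col y′) (h∘g b′) (h∘g b)
                   (twist-col< convex tw (from b) (from b′) (<⇒≤ l) q)))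
  ... | inj₂ (e , l) = ⊥-elim (<-irrefl refl (subst₂ (λ y y′ → row y ≤ row y′) (h∘g b′) (h∘g b)
                   (twist-row≤ convex tw (from b′) (from b) (≤-reflexive (sym e)) (<⇒≤ l))))

-- Remmel–Whitney tableaux as pictures

_≟ᴮ_ : DecidableEquality Box
_≟ᴮ_ = ≡-dec _≟_ _≟_

-- Lookup in the table pairing `xs` with `ys`. It turns a tableau, which lists images in reading
-- order, into a map of boxes; a box without an entry is returned unchanged as a default.
assign : List Box → List Box → Box → Box
assign [] _ z = z
assign (x ∷ xs) [] z = z
assign (x ∷ xs) (y ∷ ys) z with x ≟ᴮ z
... | yes _ = y
... | no _ = assign xs ys z

map-assign : ∀ xs ys → Unique xs → length xs ≡ length ys → map (assign xs ys) xs ≡ ys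
map-assign [] [] _ _ = refl
map-assign (x ∷ xs) (y ∷ ys) (x∉ ∷ u) e =
  cong₂ _∷_ head (trans (map-cong-local (All.map tail x∉)) (map-assign xs ys u (suc-injective e)))
  where
  head : assign (x ∷ xs) (y ∷ ys) x ≡ y
  head with x ≟ᴮ x
  ... | yes _ = refl
  ... | no x≢x = ⊥-elim (x≢x refl)
  tail : ∀ {z} → x ≢ z → assign (x ∷ xs) (y ∷ ys) z ≡ assign xs ys z
  tail {z} x≢z with x ≟ᴮ z
  ... | yes e = ⊥-elim (x≢z e)
  ... | no _ = refl

map-≡⇒pointwise : {f g : A → B} (xs : List A) → map f xs ≡ map g xs → ∀ {x} → x ∈ xs → f x ≡ g x
map-≡⇒pointwise (x ∷ xs) e (here refl) = proj₁ (∷-injective e)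
map-≡⇒pointwise (x ∷ xs) e (there m) = map-≡⇒pointwise xs (proj₂ (∷-injective e)) m

implies⁻ : ∀ a b {c} → T (not (a ∧ b) ∨ c) → T a → T b → T c
implies⁻ true true t _ _ = t

implies⁺ : ∀ a b {c} → (T a → T b → T c) → T (not (a ∧ b) ∨ c)
implies⁺ true true f = f tt tt
implies⁺ true false f = tt
implies⁺ false b f = tt

∈-RW⁻ : ∀ γ δ α β {t} → t ∈ RW γ δ α β →
  length (skewBoxes γ δ) ≡ length (rlBoxes α β) × t ↭ skewBoxes γ δ × T (isStandardFilling t) × T (rwCondition α β t)
∈-RW⁻ γ δ α β m with length (skewBoxes γ δ) ≡ᵇ length (rlBoxes α β) in eq
... | true with ∈-filterᵇ⁻ (rwCondition α β) _ m
... | m′ , rw with ∈-filterᵇ⁻ isStandardFilling _ m′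
... | m″ , st = ≡ᵇ⇒≡ _ _ (subst T (sym eq) tt) , ∈-permutations⁻ _ m″ , st , rw

∈-RW⁺ : ∀ γ δ α β {t} → length (skewBoxes γ δ) ≡ length (rlBoxes α β) → t ↭ skewBoxes γ δ →
  T (isStandardFilling t) → T (rwCondition α β t) → t ∈ RW γ δ α β
∈-RW⁺ γ δ α β e p st rw with length (skewBoxes γ δ) ≡ᵇ length (rlBoxes α β) in eq
... | true = ∈-filterᵇ⁺ (rwCondition α β) (∈-filterᵇ⁺ isStandardFilling (∈-permutations⁺ _ p) st) rw
... | false = ⊥-elim (subst T eq (≡⇒≡ᵇ _ _ e))

Unique-RW : ∀ γ δ α β → Unique (RW γ δ α β)
Unique-RW γ δ α β with length (skewBoxes γ δ) ≡ᵇ length (rlBoxes α β)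
... | true = Unique-filterᵇ⁺ (rwCondition α β) (Unique-filterᵇ⁺ isStandardFilling (Unique-permutations (Unique-skewBoxes γ δ)))
... | false = []

module _ (α β : Partition) where

  private
    rl = rlBoxes α β

  label-≺⁻ : ∀ {i j x y} → (i , x) ∈ labelled rl → (j , y) ∈ labelled rl → i < j → x ≺ y
  label-≺⁻ = labelled-increasing (rlBoxes-sorted α β)

  label-≺⁺ : ∀ {i j x y} → (i , x) ∈ labelled rl → (j , y) ∈ labelled rl → x ≺ y → i < j
  label-≺⁺ {i} {j} p q l with <-cmp i j
  ... | tri< i<j _ _ = i<j
  ... | tri≈ _ refl _ = ⊥-elim (≺-irrefl (labelled-functional rl p q) l)
  ... | tri> _ _ j<i = ⊥-elim (≺-asym l (label-≺⁻ q p j<i))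

  -- Rows are read from right to left and no box fits between horizontal neighbours in this order,
  -- so the left one carries the next label.
  label-suc : ∀ {i j k c} → (i , (k , suc c)) ∈ labelled rl → (j , (k , c)) ∈ labelled rl → j ≡ suc i
  label-suc {i} {j} p q with label-≺⁺ p q (inj₂ (refl , ≤-refl))
  ... | i<j with m≤n⇒m<n∨m≡n i<j
  ... | inj₂ e = sym e
  ... | inj₁ si<j with labelled-between rl p q i<j
  ... | z , r = ⊥-elim (gap (label-≺⁻ p r ≤-refl) (label-≺⁻ r q si<j))
    where
    gap : ∀ {z k c} → (k , suc c) ≺ z → ¬ (z ≺ (k , c))
    gap (inj₁ a) (inj₁ b) = <-asym a b
    gap (inj₁ a) (inj₂ (refl , _)) = <-irrefl refl a
    gap (inj₂ (refl , _)) (inj₁ b) = <-irrefl refl b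
    gap (inj₂ (_ , a)) (inj₂ (_ , b)) = <⇒≱ b (s≤s⁻¹ a)

  label : ∀ {x} → InSkew α β x → ∃ λ i → (i , x) ∈ labelled rl
  label s = ∈⇒labelled (∈-rlBoxes⁺ α β s)

  unlabel : ∀ {i x} → (i , x) ∈ labelled rl → InSkew α β x
  unlabel p = ∈-rlBoxes⁻ α β (labelled⇒∈ rl p)

  module _ (h : Box → Box) where

    private
      t = map h rl

    rowOf-map : ∀ {i x} → (i , x) ∈ labelled rl → rowOf t i ≡ row (h x)
    rowOf-map p = cong proj₁ (posOf-map h rl p)

    colOf-map : ∀ {i x} → (i , x) ∈ labelled rl → colOf t i ≡ col (h x)
    colOf-map p = cong proj₂ (posOf-map h rl p)

    labelled-map⁺ : ∀ {i x} → (i , x) ∈ labelled rl → (i , h x) ∈ labelled t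
    labelled-map⁺ {i} {x} p = subst ((i , h x) ∈_) (sym (labelled-map h rl)) (∈-map⁺ _ p)

    labelled-map⁻ : ∀ {i y} → (i , y) ∈ labelled t → ∃ λ x → (i , x) ∈ labelled rl × y ≡ h x
    labelled-map⁻ {i} {y} p with ∈-map⁻ _ (subst ((i , y) ∈_) (labelled-map h rl) p)
    ... | (i , x) , q , refl = x , q , refl

    -- The entry of the tableau at `h x` is the label of `x`, so comparing entries amounts to
    -- comparing preimages in the reading order.
    standard⁻ : T (isStandardFilling t) → ∀ {x x′} → InSkew α β x → InSkew α β x′ →
      (row (h x) ≡ row (h x′) → col (h x) < col (h x′) → x ≺ x′) ×
      (col (h x) ≡ col (h x′) → row (h x) < row (h x′) → x ≺ x′)
    standard⁻ st {x} {x′} s s′ with label s | label s′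
    ... | i , p | j , q with T-∧⁻ _ (allᵇ⁻ _ st (∈-pairsOf⁺ (labelled-map⁺ p) (labelled-map⁺ q)))
    ... | f , g =
      (λ e l → label-≺⁻ p q (<ᵇ⇒< i j (implies⁻ (row (h x) ≡ᵇ row (h x′)) (col (h x) <ᵇ col (h x′)) f (≡⇒≡ᵇ _ _ e) (<⇒<ᵇ l)))) ,
      (λ e l → label-≺⁻ p q (<ᵇ⇒< i j (implies⁻ (col (h x) ≡ᵇ col (h x′)) (row (h x) <ᵇ row (h x′)) g (≡⇒≡ᵇ _ _ e) (<⇒<ᵇ l))))

    standard⁺ : (∀ {x x′} → InSkew α β x → InSkew α β x′ →
      (row (h x) ≡ row (h x′) → col (h x) < col (h x′) → x ≺ x′) ×
      (col (h x) ≡ col (h x′) → row (h x) < row (h x′) → x ≺ x′)) → T (isStandardFilling t)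
    standard⁺ H = allᵇ⁺ _ (pairsOf (labelled t)) go
      where
      go : ∀ z → z ∈ pairsOf (labelled t) → _
      go ((i , y) , (j , y′)) m with ∈-pairsOf⁻ (labelled t) m
      ... | p , q with labelled-map⁻ p | labelled-map⁻ q
      ... | x , p′ , refl | x′ , q′ , refl with H (unlabel p′) (unlabel q′)
      ... | f , g = T-∧⁺
        (implies⁺ (row (h x) ≡ᵇ row (h x′)) (col (h x) <ᵇ col (h x′)) λ e l → <⇒<ᵇ (label-≺⁺ p′ q′ (f (≡ᵇ⇒≡ _ _ e) (<ᵇ⇒< _ _ l))))
        (implies⁺ (col (h x) ≡ᵇ col (h x′)) (row (h x) <ᵇ row (h x′)) λ e l → <⇒<ᵇ (label-≺⁺ p′ q′ (g (≡ᵇ⇒≡ _ _ e) (<ᵇ⇒< _ _ l))))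

    rw⁻ : T (rwCondition α β t) → Twisting (InSkew α β) h
    rw⁻ rw = record { right = R ; down = D }
      where
      R : ∀ {i c} → InSkew α β (i , c) → InSkew α β (i , suc c) →
        col (h (i , suc c)) < col (h (i , c)) × row (h (i , c)) ≤ row (h (i , suc c))
      R {k} {c} s s′ with label s′ | label s
      ... | i , p | j , q
        with T-∧⁻ _ (implies⁻ (j ≡ᵇ suc i) (k ≡ᵇ k) (proj₁ (T-∧⁻ _ (allᵇ⁻ _ rw (∈-pairsOf⁺ p q))))
               (≡⇒≡ᵇ j (suc i) (label-suc p q)) (≡⇒≡ᵇ k k refl))
      ... | a , b = subst₂ _<_ (colOf-map p) (colOf-map q) (<ᵇ⇒< _ _ a) , subst₂ _≤_ (rowOf-map q) (rowOf-map p) (≤ᵇ⇒≤ _ _ b)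
      D : ∀ {i c} → InSkew α β (i , c) → InSkew α β (suc i , c) →
        row (h (i , c)) < row (h (suc i , c)) × col (h (suc i , c)) ≤ col (h (i , c))
      D {k} {c} s s′ with label s | label s′
      ... | i , p | j , q
        with T-∧⁻ _ (implies⁻ (suc k ≡ᵇ suc k) (c ≡ᵇ c) (proj₂ (T-∧⁻ _ (allᵇ⁻ _ rw (∈-pairsOf⁺ p q))))
               (≡⇒≡ᵇ k k refl) (≡⇒≡ᵇ c c refl))
      ... | a , b = subst₂ _<_ (rowOf-map p) (rowOf-map q) (<ᵇ⇒< _ _ a) , subst₂ _≤_ (colOf-map q) (colOf-map p) (≤ᵇ⇒≤ _ _ b)

    rw⁺ : IsPartition α → IsPartition β → Twisting (InSkew α β) h → T (rwCondition α β t)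
    rw⁺ pα pβ tw = allᵇ⁺ _ (pairsOf (labelled rl)) go
      where
      convex = inSkew-convex pα pβ
      go : ∀ z → z ∈ pairsOf (labelled rl) → _
      go ((i , (ri , ci)) , (j , (rj , cj))) m with ∈-pairsOf⁻ (labelled rl) m
      ... | p , q = T-∧⁺
        (implies⁺ (j ≡ᵇ suc i) (ri ≡ᵇ rj) λ e e′ → R (≡ᵇ⇒≡ j (suc i) e) (≡ᵇ⇒≡ ri rj e′))
        (implies⁺ (rj ≡ᵇ suc ri) (cj ≡ᵇ ci) λ e e′ → D (≡ᵇ⇒≡ rj (suc ri) e) (≡ᵇ⇒≡ cj ci e′))
        where
        R : j ≡ suc i → ri ≡ rj → T ((colOf t i <ᵇ colOf t j) ∧ (rowOf t j ≤ᵇ rowOf t i))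
        -- The order of the labels says only that the second box lies somewhere to the left in the
        -- row; the extended twisting condition covers every horizontal distance.
        R refl refl with label-≺⁻ p q ≤-refl
        ... | inj₁ l = ⊥-elim (<-irrefl refl l)
        ... | inj₂ (_ , l) = T-∧⁺
          (<⇒<ᵇ (subst₂ _<_ (sym (colOf-map p)) (sym (colOf-map q)) (twist-col< convex tw (unlabel q) (unlabel p) ≤-refl l)))
          (≤⇒≤ᵇ (subst₂ _≤_ (sym (rowOf-map q)) (sym (rowOf-map p)) (twist-row≤ convex tw (unlabel q) (unlabel p) ≤-refl (<⇒≤ l))))
        D : rj ≡ suc ri → cj ≡ ci → T ((rowOf t i <ᵇ rowOf t j) ∧ (colOf t j ≤ᵇ colOf t i))
        D refl refl with Twisting.down tw (unlabel p) (unlabel q)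
        ... | a , b = T-∧⁺
          (<⇒<ᵇ (subst₂ _<_ (sym (rowOf-map p)) (sym (rowOf-map q)) a))
          (≤⇒≤ᵇ (subst₂ _≤_ (sym (colOf-map q)) (sym (colOf-map p)) b))

length-RW : ∀ {α β γ δ t} → t ∈ RW γ δ α β → length (rlBoxes α β) ≡ length t
length-RW {α} {β} {γ} {δ} m with ∈-RW⁻ γ δ α β m
... | e , perm , _ = trans (sym e) (sym (↭-length perm))

-- Standardness yields only the reading order of the preimages of neighbours; `inverse-twists`
-- sharpens this to the twisting of `g`, using that of `h`.
RW⇒picture : ∀ {α β γ δ} → IsPartition α → IsPartition β → ∀ h → map h (rlBoxes α β) ∈ RW γ δ α β →
  ∃ λ g → Picture (InSkew α β) (InSkew γ δ) h g
RW⇒picture {α} {β} {γ} {δ} pα pβ h m with ∈-RW⁻ γ δ α β m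
... | e , perm , st , rw = g , record
  { to = λ {x} s → ∈-skewBoxes⁻ γ δ (∈-resp-↭ perm (∈-map⁺ h (∈-rlBoxes⁺ α β s)))
  ; from = from
  ; g∘h = g∘h
  ; h∘g = h∘g
  ; h-twists = tw
  ; g-twists = inverse-twists (inSkew-convex pα pβ) tw from h∘g
      (λ b b′ → proj₁ (standard⁻ α β h st (from b) (from b′))
        (trans (cong row (h∘g b)) (sym (cong row (h∘g b′))))
        (subst₂ (λ y y′ → col y < col y′) (sym (h∘g b)) (sym (h∘g b′)) ≤-refl))
      (λ b b′ → proj₂ (standard⁻ α β h st (from b) (from b′))
        (trans (cong col (h∘g b)) (sym (cong col (h∘g b′))))
        (subst₂ (λ y y′ → row y < row y′) (sym (h∘g b)) (sym (h∘g b′)) ≤-refl))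
  }
  where
  tw = rw⁻ α β h rw
  -- The inverse is the same table read backwards, which works because the boxes of a tableau are
  -- distinct.
  g = assign (map h (rlBoxes α β)) (rlBoxes α β)
  eg : map g (map h (rlBoxes α β)) ≡ rlBoxes α β
  eg = map-assign (map h (rlBoxes α β)) (rlBoxes α β)
    (↭ₛ.Unique-resp-↭ (setoid Box) (↭⇒↭ₛ (↭-sym perm)) (Unique-skewBoxes γ δ)) (length-map h (rlBoxes α β))
  g∘h : ∀ {x} → InSkew α β x → g (h x) ≡ x
  g∘h s = map-≡⇒pointwise (rlBoxes α β) (trans (map-∘ (rlBoxes α β)) (trans eg (sym (map-id (rlBoxes α β))))) (∈-rlBoxes⁺ α β s)
  preimage : ∀ {y} → InSkew γ δ y → ∃ λ x → x ∈ rlBoxes α β × y ≡ h x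
  preimage b = ∈-map⁻ h (∈-resp-↭ (↭-sym perm) (∈-skewBoxes⁺ γ δ b))
  from : ∀ {y} → InSkew γ δ y → InSkew α β (g y)
  from b with preimage b
  ... | x , x∈ , refl = subst (InSkew α β) (sym (g∘h (∈-rlBoxes⁻ α β x∈))) (∈-rlBoxes⁻ α β x∈)
  h∘g : ∀ {y} → InSkew γ δ y → h (g y) ≡ y
  h∘g b with preimage b
  ... | x , x∈ , refl = cong h (g∘h (∈-rlBoxes⁻ α β x∈))

-- Standardness comes from the twisting of `g`: further right in a row, preimages lie strictly left
-- and weakly lower; further down a column, strictly lower. In both cases they come later in the
-- reading order.
picture⇒RW : ∀ {α β γ δ} → IsPartition α → IsPartition β → IsPartition γ → IsPartition δ → ∀ {h g} →
  Picture (InSkew α β) (InSkew γ δ) h g → map h (rlBoxes α β) ∈ RW γ δ α β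
picture⇒RW {α} {β} {γ} {δ} pα pβ pγ pδ {h} {g} P = ∈-RW⁺ γ δ α β
  (trans (sym (↭-length perm)) (length-map h (rlBoxes α β))) perm
  (standard⁺ α β h λ s s′ →
    (λ e l → let c = subst₂ (λ x x′ → col x′ < col x) (g∘h s) (g∘h s′) (twist-col< conv g-twists (to s) (to s′) (≤-reflexive e) l)
                 r = subst₂ (λ x x′ → row x ≤ row x′) (g∘h s) (g∘h s′) (twist-row≤ conv g-twists (to s) (to s′) (≤-reflexive e) (<⇒≤ l))
             in weak r c) ,
    (λ e l → inj₁ (subst₂ (λ x x′ → row x < row x′) (g∘h s) (g∘h s′) (twist-row< conv g-twists (to s) (to s′) l (≤-reflexive e)))))
  (rw⁺ α β h pα pβ h-twists)
  where
  open Picture P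
  conv = inSkew-convex pγ pδ
  weak : ∀ {x x′} → row x ≤ row x′ → col x′ < col x → x ≺ x′
  weak r c with m≤n⇒m<n∨m≡n r
  ... | inj₁ l = inj₁ l
  ... | inj₂ e = inj₂ (e , c)
  perm : map h (rlBoxes α β) ↭ skewBoxes γ δ
  perm = unique-set⇒↭
    (Unique-map⁺ h (Unique-rlBoxes α β) λ p q e →
      trans (sym (g∘h (∈-rlBoxes⁻ α β p))) (trans (cong g e) (g∘h (∈-rlBoxes⁻ α β q))))
    (Unique-skewBoxes γ δ)
    (λ p → let (x , x∈ , e) = ∈-map⁻ h p in subst (_∈ skewBoxes γ δ) (sym e) (∈-skewBoxes⁺ γ δ (to (∈-rlBoxes⁻ α β x∈))))
    (λ p → let b = ∈-skewBoxes⁻ γ δ p in subst (_∈ map h (rlBoxes α β)) (h∘g b) (∈-map⁺ h (∈-rlBoxes⁺ α β (from b))))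

-- Membership and uniqueness in the list of arrows from a vertex

eqList⇒≡ : ∀ xs ys → T (eqList xs ys) → xs ≡ ys
eqList⇒≡ [] [] t = refl
eqList⇒≡ (x ∷ xs) (y ∷ ys) t with T-∧⁻ (x ≡ᵇ y) t
... | p , q = cong₂ _∷_ (≡ᵇ⇒≡ x y p) (eqList⇒≡ xs ys q)

eqList-refl : ∀ xs → T (eqList xs xs)
eqList-refl [] = tt
eqList-refl (x ∷ xs) = T-∧⁺ (≡⇒≡ᵇ x x refl) (eqList-refl xs)

eqPair⇒≡ : ∀ p q → T (eqPair p q) → p ≡ q
eqPair⇒≡ (a , b) (c , d) t with T-∧⁻ (eqList a c) t
... | p , q = cong₂ _,_ (eqList⇒≡ a c p) (eqList⇒≡ b d q)

eqPair-refl : ∀ p → T (eqPair p p)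
eqPair-refl (a , b) = T-∧⁺ (eqList-refl a) (eqList-refl b)

IsPair : Pair → Set
IsPair (α₁ , α₂) = IsPartition α₁ × IsPartition α₂

-- The equality of box counts required of an arrow is not recorded, since a picture between the two
-- skew shapes implies it. The case `q ≡ p` is allowed, to accommodate identities.
record Link (p q : Pair) : Set where
  field
    target-isPair : IsPair q
    grows : proj₁ p ⊑ proj₁ q
    shrinks : proj₂ q ⊑ proj₂ p

Outer Inner : Pair → Pair → Box → Set
Outer p q = InSkew (proj₂ p) (proj₂ q)
Inner p q = InSkew (proj₁ q) (proj₁ p)

labels : Pair → Pair → List Box
labels p q = rlBoxes (proj₂ p) (proj₂ q)

private
  toTargets : Pair → Partition → Partition → List Arrow
  toTargets (α₁ , α₂) β₂ β₁ = if eqPair (β₁ , β₂) (α₁ , α₂) then [] else map (arrow (β₁ , β₂)) (RW β₁ α₁ α₂ β₂)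

  firsts : Pair → Partition → List Partition
  firsts (α₁ , α₂) β₂ = filterᵇ (λ β₁ → α₁ ⊆ᵇ β₁) (partitionsOf (size α₁ + (size α₂ ∸ size β₂)))

  ∈-toTargets⁻ : ∀ p β₂ β₁ {a} → a ∈ toTargets p β₂ β₁ →
    (β₁ , β₂) ≢ p × target a ≡ (β₁ , β₂) × tableau a ∈ RW β₁ (proj₁ p) (proj₂ p) β₂
  ∈-toTargets⁻ p β₂ β₁ m with eqPair (β₁ , β₂) p in eq
  ... | false with ∈-map⁻ (arrow (β₁ , β₂)) m
  ... | t , t∈ , refl = (λ { refl → subst T eq (eqPair-refl (β₁ , β₂)) }) , refl , t∈

  ∈-toTargets⁺ : ∀ p β₂ β₁ {t} → (β₁ , β₂) ≢ p → t ∈ RW β₁ (proj₁ p) (proj₂ p) β₂ →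
    arrow (β₁ , β₂) t ∈ toTargets p β₂ β₁
  ∈-toTargets⁺ p β₂ β₁ ne m with eqPair (β₁ , β₂) p in eq
  ... | false = ∈-map⁺ (arrow (β₁ , β₂)) m
  ... | true = ⊥-elim (ne (eqPair⇒≡ _ _ (subst T (sym eq) tt)))

  Unique-toTargets : ∀ p β₂ β₁ → Unique (toTargets p β₂ β₁)
  Unique-toTargets p β₂ β₁ with eqPair (β₁ , β₂) p
  ... | false = Unique.map⁺ (cong tableau) (Unique-RW β₁ (proj₁ p) (proj₂ p) β₂)
  ... | true = []

∈-arrowsFrom⁻ : ∀ p {a} → a ∈ arrowsFrom p → let q = target a in
  q ≢ p × IsPair q × T (proj₂ q ⊆ᵇ proj₂ p) × T (proj₁ p ⊆ᵇ proj₁ q) ×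
  size (proj₁ q) ≡ size (proj₁ p) + (size (proj₂ p) ∸ size (proj₂ q)) ×
  tableau a ∈ RW (proj₁ q) (proj₁ p) (proj₂ p) (proj₂ q)
∈-arrowsFrom⁻ p {a} m
  with ∈-concatMap-elim (λ β₂ → concatMap (toTargets p β₂) (firsts p β₂)) {subPartitions (proj₂ p)} m
... | β₂ , β₂∈ , m′ with ∈-concatMap-elim (toTargets p β₂) {firsts p β₂} m′
... | β₁ , β₁∈ , m″ with ∈-toTargets⁻ p β₂ β₁ m″
... | ne , refl , t∈ with ∈-subPartitions⁻ {proj₂ p} β₂∈ | ∈-filterᵇ⁻ (λ β₁ → proj₁ p ⊆ᵇ β₁) _ β₁∈
... | pβ₂ , sub | β₁∈′ , sub′ with ∈-partitionsOf⁻ _ β₁∈′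
... | pβ₁ , e = ne , (pβ₁ , pβ₂) , sub , sub′ , e , t∈

∈-arrowsFrom⁺ : ∀ p {q t} → q ≢ p → IsPair q → T (proj₂ q ⊆ᵇ proj₂ p) → T (proj₁ p ⊆ᵇ proj₁ q) →
  size (proj₁ q) ≡ size (proj₁ p) + (size (proj₂ p) ∸ size (proj₂ q)) →
  t ∈ RW (proj₁ q) (proj₁ p) (proj₂ p) (proj₂ q) → arrow q t ∈ arrowsFrom p
∈-arrowsFrom⁺ p {β₁ , β₂} ne (pβ₁ , pβ₂) sub sub′ e t∈ =
  ∈-concatMap-intro (λ β₂ → concatMap (toTargets p β₂) (firsts p β₂)) (∈-subPartitions⁺ pβ₂ sub)
    (∈-concatMap-intro (toTargets p β₂) (∈-filterᵇ⁺ (λ β₁ → proj₁ p ⊆ᵇ β₁) (∈-partitionsOf⁺ pβ₁ e) sub′)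
      (∈-toTargets⁺ p β₂ β₁ ne t∈))

Unique-arrowsFrom : ∀ p → Unique (arrowsFrom p)
Unique-arrowsFrom p = Unique-concatMap⁺ (λ β₂ → concatMap (toTargets p β₂) (firsts p β₂)) (Unique-subPartitions (proj₂ p))
  (λ {β₂} _ → Unique-concatMap⁺ (toTargets p β₂)
    (Unique-filterᵇ⁺ (λ β₁ → proj₁ p ⊆ᵇ β₁) (Unique-partsBounded (n β₂) (n β₂) (n β₂)))
    (λ {β₁} _ → Unique-toTargets p β₂ β₁)
    (λ {β₁} {β₁′} _ _ m m′ → cong proj₁ (trans (sym (tgt β₂ β₁ m)) (tgt β₂ β₁′ m′))))
  (λ {β₂} {β₂′} _ _ m m′ →
    let (β₁ , _ , k) = ∈-concatMap-elim (toTargets p β₂) {firsts p β₂} m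
        (β₁′ , _ , k′) = ∈-concatMap-elim (toTargets p β₂′) {firsts p β₂′} m′
    in cong proj₂ (trans (sym (tgt β₂ β₁ k)) (tgt β₂′ β₁′ k′)))
  where
  n : Partition → ℕ
  n β₂ = size (proj₁ p) + (size (proj₂ p) ∸ size β₂)
  tgt : ∀ β₂ β₁ {a} → a ∈ toTargets p β₂ β₁ → target a ≡ (β₁ , β₂)
  tgt β₂ β₁ m = proj₁ (proj₂ (∈-toTargets⁻ p β₂ β₁ m))

-- Empty skew shapes and the decrease of size along arrows

skew-empty : ∀ α {x} → ¬ InSkew α α x
skew-empty α (_ , p , q) = <⇒≱ p q

rlBoxes-empty : ∀ α → rlBoxes α α ≡ []
rlBoxes-empty α with rlBoxes α α in eq
... | [] = refl
... | x ∷ xs = ⊥-elim (skew-empty α (∈-rlBoxes⁻ α α (subst (x ∈_) (sym eq) (here refl))))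

⊆ᵇ-size-≡ : ∀ {α β} → IsPartition α → IsPartition β → T (β ⊆ᵇ α) → size β ≡ size α → β ≡ α
⊆ᵇ-size-≡ {α} {β} (_ , pα) (_ , pβ) t e = ⊑-antisym pβ pα (⊆ᵇ⇒⊑ β α t) (λ i → ≮⇒≥ (noBox i))
  where
  noBoxes : length (skewBoxes α β) ≡ 0
  noBoxes = +-cancelʳ-≡ (sum β) _ 0 (trans (length-skewBoxes {α} {β} t) (sym e))
  noBox : ∀ i → ¬ (at β i < at α i)
  noBox i l = <⇒≱ (∈-length (∈-skewBoxes⁺ α β {suc i , at α i} (s≤s z≤n , l , ≤-refl))) (≤-reflexive noBoxes)

-- If the second partition kept its size, so would the first; both inclusions would be equalities
-- and the target would be `p`, which is excluded. This makes the recursions for the bases well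
-- founded.
target-smaller : ∀ {p} → IsPair p → ∀ {a} → a ∈ arrowsFrom p → size (proj₂ (target a)) < size (proj₂ p)
target-smaller {α₁ , α₂} (pα₁ , pα₂) {arrow (β₁ , β₂) t} m =
  let (ne , (pβ₁ , pβ₂) , sub , sub′ , e , _) = ∈-arrowsFrom⁻ (α₁ , α₂) m in
  ≤∧≢⇒< (⊑⇒sum≤ {β₂} {α₂} sub) λ same → ne (cong₂ _,_
  (sym (⊆ᵇ-size-≡ pβ₁ pα₁ sub′ (sym (trans e (trans (cong (λ n → size α₁ + (size α₂ ∸ n)) same)
     (trans (cong (size α₁ +_) (n∸n≡0 (size α₂))) (+-identityʳ (size α₁))))))))
  (⊆ᵇ-size-≡ pα₂ pβ₂ sub same))

-- Arrows together with an identity at each vertex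

identity : Pair → Arrow
identity p = arrow p []

arrowsFrom₊ : Pair → List Arrow
arrowsFrom₊ p = identity p ∷ arrowsFrom p

Unique-arrowsFrom₊ : ∀ p → Unique (arrowsFrom₊ p)
Unique-arrowsFrom₊ p = All.tabulate (λ m e → proj₁ (∈-arrowsFrom⁻ p m) (cong target (sym e))) ∷ Unique-arrowsFrom p

boxMap : Pair → Arrow → Box → Box
boxMap p a = assign (labels p (target a)) (tableau a)

map-boxMap : ∀ {p} {a} → a ∈ arrowsFrom₊ p → tableau a ≡ map (boxMap p a) (labels p (target a))
map-boxMap {p} (here refl) rewrite rlBoxes-empty (proj₂ p) = refl
map-boxMap {p} {a} (there m) =
  let (_ , _ , _ , _ , _ , t∈) = ∈-arrowsFrom⁻ p m in
  sym (map-assign (labels p (target a)) (tableau a) (Unique-rlBoxes (proj₂ p) (proj₂ (target a)))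
  (length-RW {proj₂ p} {proj₂ (target a)} {proj₁ (target a)} {proj₁ p} t∈))

∈-arrowsFrom₊⁻ : ∀ {p} → IsPair p → ∀ {a} → a ∈ arrowsFrom₊ p →
  Link p (target a) × ∃ λ g → Picture (Outer p (target a)) (Inner p (target a)) (boxMap p a) g
∈-arrowsFrom₊⁻ {p} pp (here refl) = record { target-isPair = pp ; grows = λ i → ≤-refl ; shrinks = λ i → ≤-refl } , (λ x → x) , record
  { to = λ s → ⊥-elim (skew-empty (proj₂ p) s)
  ; from = λ s → ⊥-elim (skew-empty (proj₁ p) s)
  ; g∘h = λ s → ⊥-elim (skew-empty (proj₂ p) s)
  ; h∘g = λ s → ⊥-elim (skew-empty (proj₁ p) s)
  ; h-twists = record { right = λ s → ⊥-elim (skew-empty (proj₂ p) s) ; down = λ s → ⊥-elim (skew-empty (proj₂ p) s) }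
  ; g-twists = record { right = λ s → ⊥-elim (skew-empty (proj₁ p) s) ; down = λ s → ⊥-elim (skew-empty (proj₁ p) s) }
  }
∈-arrowsFrom₊⁻ {p} pp {a} (there m) =
  let (_ , pq , sub , sub′ , _ , t∈) = ∈-arrowsFrom⁻ p m in
  record { target-isPair = pq ; grows = ⊆ᵇ⇒⊑ (proj₁ p) (proj₁ (target a)) sub′ ; shrinks = ⊆ᵇ⇒⊑ (proj₂ (target a)) (proj₂ p) sub } ,
  RW⇒picture {γ = proj₁ (target a)} {proj₁ p} (proj₂ pp) (proj₂ pq) (boxMap p a)
    (subst (_∈ RW (proj₁ (target a)) (proj₁ p) (proj₂ p) (proj₂ (target a))) (map-boxMap {p} (there m)) t∈)

∈-arrowsFrom₊⁺ : ∀ {p} → IsPair p → ∀ {q} → Link p q → ∀ {h g} → Picture (Outer p q) (Inner p q) h g →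
  arrow q (map h (labels p q)) ∈ arrowsFrom₊ p
∈-arrowsFrom₊⁺ {p@(α₁ , α₂)} (pα₁ , pα₂) {q@(β₁ , β₂)} L {h} P with eqPair q p in eq
... | true with eqPair⇒≡ q p (subst T (sym eq) tt)
... | refl rewrite rlBoxes-empty α₂ = here refl
∈-arrowsFrom₊⁺ {p@(α₁ , α₂)} (pα₁ , pα₂) {q@(β₁ , β₂)} L {h} P | false =
  there (∈-arrowsFrom⁺ p (λ { refl → subst T eq (eqPair-refl q) }) (pβ₁ , pβ₂) sub sub′ sizes t∈)
  where
  open Link L
  pβ₁ = proj₁ target-isPair
  pβ₂ = proj₂ target-isPair
  sub = ⊑⇒⊆ᵇ α₂ (proj₂ pβ₂) shrinks
  sub′ = ⊑⇒⊆ᵇ β₁ (proj₂ pα₁) grows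
  t∈ = picture⇒RW pα₂ pβ₂ pβ₁ pα₁ P
  lengths : length (skewBoxes β₁ α₁) ≡ length (skewBoxes α₂ β₂)
  lengths = trans (proj₁ (∈-RW⁻ β₁ α₁ α₂ β₂ t∈)) (↭-length (rlBoxes↭skewBoxes α₂ β₂))
  sizes : size β₁ ≡ size α₁ + (size α₂ ∸ size β₂)
  sizes = trans (sym (length-skewBoxes {β₁} {α₁} sub′)) (trans (+-comm _ (size α₁)) (cong (size α₁ +_)
    (trans lengths (trans (sym (m+n∸n≡m _ (size β₂))) (cong (_∸ size β₂) (length-skewBoxes {α₂} {β₂} sub))))))

-- Row rules

-- R_r(x) = r + row x − col x ≤ row y, with col x moved across to avoid subtraction.
Rule : ℕ → Box → Box → Set
Rule r x y = r + row x ≤ row y + col x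

[i-j]+j≡i : ∀ i j → (i ℤ.- j) ℤ.+ j ≡ i
[i-j]+j≡i i j = trans (ℤ.+-assoc i (ℤ.- j) j) (trans (cong (λ k → i ℤ.+ k) (ℤ.+-inverseˡ j)) (ℤ.+-identityʳ i))

[i+j]-j≡i : ∀ i j → (i ℤ.+ j) ℤ.- j ≡ i
[i+j]-j≡i i j = trans (ℤ.+-assoc i j (ℤ.- j)) (trans (cong (λ k → i ℤ.+ k) (ℤ.+-inverseʳ j)) (ℤ.+-identityʳ i))

entry≤⇒rule : ∀ n c m → T (((ℤ.+ n) ℤ.- (ℤ.+ c)) ℤ.≤ᵇ (ℤ.+ m)) → n ≤ m + c
entry≤⇒rule n c m t = ℤ.drop‿+≤+ (subst (ℤ._≤ ℤ.+ (m + c)) ([i-j]+j≡i (ℤ.+ n) (ℤ.+ c))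
  (ℤ.+-monoˡ-≤ (ℤ.+ c) (ℤ.≤ᵇ⇒≤ {(ℤ.+ n) ℤ.- (ℤ.+ c)} {ℤ.+ m} t)))

rule⇒entry≤ : ∀ n c m → n ≤ m + c → T (((ℤ.+ n) ℤ.- (ℤ.+ c)) ℤ.≤ᵇ (ℤ.+ m))
rule⇒entry≤ n c m l = ℤ.≤⇒≤ᵇ (subst (((ℤ.+ n) ℤ.- (ℤ.+ c)) ℤ.≤_) ([i+j]-j≡i (ℤ.+ m) (ℤ.+ c))
  (ℤ.+-monoˡ-≤ (ℤ.- (ℤ.+ c)) (ℤ.+≤+ l)))

T-not⁻ : ∀ b → T (not b) → ¬ T b
T-not⁻ false _ ()

T-not⁺ : ∀ b → ¬ T b → T (not b)
T-not⁺ false _ = tt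
T-not⁺ true ¬t = ¬t tt

module _ (r : ℕ) (p q : Pair) (h : Box → Box) where

  private
    a = arrow q (map h (labels p q))

  rowRule⁻ : T (satisfiesRowRule r p a) → ∀ {x} → Outer p q x → Rule r x (h x)
  rowRule⁻ t {x} s with label (proj₂ p) (proj₂ q) s
  ... | i , m = subst (λ k → r + row x ≤ k + col x) (rowOf-map (proj₂ p) (proj₂ q) h m)
    (entry≤⇒rule (r + row x) (col x) _ (allᵇ⁻ _ t (∈-map⁺ _ m)))

  rowRule⁺ : (∀ {x} → Outer p q x → Rule r x (h x)) → T (satisfiesRowRule r p a)
  rowRule⁺ H = allᵇ⁺ _ (rowRuleValues r p a) go
    where
    go : ∀ z → z ∈ rowRuleValues r p a → _
    go z m with ∈-map⁻ _ {xs = labelled (labels p q)} m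
    ... | (i , x) , n , refl = rule⇒entry≤ (r + row x) (col x) _
      (subst (λ k → r + row x ≤ k + col x) (sym (rowOf-map (proj₂ p) (proj₂ q) h n)) (H (unlabel (proj₂ p) (proj₂ q) n)))

  reverseRowRule⁻ : T (satisfiesReverseRowRule r p a) → ∀ {x} → Outer p q x → ¬ Rule r x (h x)
  reverseRowRule⁻ t {x} s l with label (proj₂ p) (proj₂ q) s
  ... | i , m = T-not⁻ _ (allᵇ⁻ _ t (∈-map⁺ _ m)) (rule⇒entry≤ (r + row x) (col x) _
    (subst (λ k → r + row x ≤ k + col x) (sym (rowOf-map (proj₂ p) (proj₂ q) h m)) l))

  reverseRowRule⁺ : (∀ {x} → Outer p q x → ¬ Rule r x (h x)) → T (satisfiesReverseRowRule r p a)
  reverseRowRule⁺ H = allᵇ⁺ _ (rowRuleValues r p a) go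
    where
    go : ∀ z → z ∈ rowRuleValues r p a → _
    go z m with ∈-map⁻ _ {xs = labelled (labels p q)} m
    ... | (i , x) , n , refl = T-not⁺ _ λ t → H (unlabel (proj₂ p) (proj₂ q) n)
      (subst (λ k → r + row x ≤ k + col x) (rowOf-map (proj₂ p) (proj₂ q) h n) (entry≤⇒rule (r + row x) (col x) _ t))

rule? : ∀ r x y → Dec (Rule r x y)
rule? r x y = r + row x ≤? row y + col x

-- Skew shapes cut by an intermediate partition

⊑-from-boxes : ∀ β α → (∀ i c → 1 ≤ c → c ≤ at β i → c ≤ at α i) → β ⊑ α
⊑-from-boxes β α H i with at β i in eq
... | zero = z≤n
... | suc c = H i (suc c) (s≤s z≤n) (≤-reflexive (sym eq))

-- All boxes weakly above and weakly left of a box of `β` belong to `β`. This rules out neighbours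
-- crossing a cut in the wrong direction, and for the remaining crossings it turns knowledge of one
-- coordinate into knowledge of the other.
no-outer-before-inner : ∀ {α β γ x y} → IsPartition β → InSkew α β x → InSkew β γ y →
  row x ≤ row y → ¬ (col x ≤ col y)
no-outer-before-inner pβ (_ , β<x , _) (_ , _ , y≤β) r c =
  <⇒≱ β<x (≤-trans c (≤-trans y≤β (rowLen-antitone pβ r)))

skew-split : ∀ {α} β {γ x} → InSkew α γ x → InSkew β γ x ⊎ InSkew α β x
skew-split β {x = x} (p , q , s) with col x ≤? rowLen β (row x)
... | yes l = inj₁ (p , q , l)
... | no ¬l = inj₂ (p , ≰⇒> ¬l , s)

skew-disjoint : ∀ {α β γ x} → InSkew β γ x → ¬ InSkew α β x
skew-disjoint (_ , _ , l) (_ , l′ , _) = <⇒≱ l′ l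

skew-weakenˡ : ∀ {α β γ x} → β ⊑ α → InSkew β γ x → InSkew α γ x
skew-weakenˡ {x = x} l (p , q , s) = p , q , ≤-trans s (l (row x ∸ 1))

skew-weakenʳ : ∀ {α β γ x} → γ ⊑ β → InSkew α β x → InSkew α γ x
skew-weakenʳ {x = x} l (p , q , s) = p , ≤-trans (s≤s (l (row x ∸ 1))) q , s

-- Concatenating pictures

splice : (β γ : Partition) → (Box → Box) → (Box → Box) → Box → Box
splice β γ f g x with inSkew? β γ x
... | yes _ = f x
... | no _ = g x

splice-in : ∀ {β γ f g x} → InSkew β γ x → splice β γ f g x ≡ f x
splice-in {β} {γ} {x = x} s with inSkew? β γ x
... | yes _ = refl
... | no ¬s = ⊥-elim (¬s s)

splice-out : ∀ {β γ f g x} → ¬ InSkew β γ x → splice β γ f g x ≡ g x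
splice-out {β} {γ} {x = x} ¬s with inSkew? β γ x
... | yes s = ⊥-elim (¬s s)
... | no _ = refl

-- Here (a , b) and (a′ , b′) are source boxes with image rows `i` and `i′`. The first obeys the row
-- rule and the second violates it; adding the two inequalities cancels `r` and leaves a comparison
-- of row minus column.
rule-trade : ∀ {r a b a′ b′ i i′} → r + a ≤ i + b → i′ + b′ < r + a′ → i ≤ i′ → a + b′ < a′ + b
rule-trade {r} {a} {b} {a′} {b′} {i} {i′} p q l = +-cancelˡ-< (r + i) _ _ (begin-strict
  (r + i) + (a + b′)   ≡⟨ interchange r i a b′ ⟩
  (r + a) + (i + b′)   ≤⟨ +-mono-≤ p (+-monoˡ-≤ b′ l) ⟩
  (i + b) + (i′ + b′)  <⟨ +-monoʳ-< (i + b) q ⟩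
  (i + b) + (r + a′)   ≡⟨ +-comm (i + b) (r + a′) ⟩
  (r + a′) + (i + b)   ≡⟨ interchange r a′ i b ⟩
  (r + i) + (a′ + b)   ∎)
  where open ≤-Reasoning

trade-col : ∀ {a b a′ b′} → a + b′ < a′ + b → a′ ≤ a → b′ ≤ b
trade-col {a} {b} {a′} {b′} p l = ≮⇒≥ λ b<b′ → <⇒≱ p (+-mono-≤ l (<⇒≤ b<b′))

module _ (r : ℕ) {p q t : Pair} (L : Link p q) (L′ : Link q t) {ha ga hb gb : Box → Box}
  (Pa : Picture (Outer p q) (Inner p q) ha ga) (Pb : Picture (Outer q t) (Inner q t) hb gb) where

  private
    module a = Picture Pa
    module b = Picture Pb
    α₁ = proj₁ p
    α₂ = proj₂ p
    β₁ = proj₁ q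
    β₂ = proj₂ q
    γ₁ = proj₁ t
    γ₂ = proj₂ t
    pβ₁ = proj₁ (Link.target-isPair L)
    pβ₂ = proj₂ (Link.target-isPair L)
    pγ₁ = proj₁ (Link.target-isPair L′)
    pγ₂ = proj₂ (Link.target-isPair L′)

  -- The cut has opposite orientations on the two sides: the first picture occupies the outer part
  -- of the source but the inner part of the target. The test in `splice` therefore selects `hb` for
  -- the map and `ga` for its inverse.
  spliced spliced⁻¹ : Box → Box
  spliced = splice β₂ γ₂ hb ha
  spliced⁻¹ = splice β₁ α₁ ga gb

  spliced-a : ∀ {x} → Outer p q x → spliced x ≡ ha x
  spliced-a s = splice-out {β₂} {γ₂} λ s′ → skew-disjoint {α₂} {β₂} {γ₂} s′ s

  spliced-b : ∀ {x} → Outer q t x → spliced x ≡ hb x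
  spliced-b s = splice-in {β₂} {γ₂} s

  spliced⁻¹-a : ∀ {y} → Inner p q y → spliced⁻¹ y ≡ ga y
  spliced⁻¹-a s = splice-in {β₁} {α₁} s

  spliced⁻¹-b : ∀ {y} → Inner q t y → spliced⁻¹ y ≡ gb y
  spliced⁻¹-b s = splice-out {β₁} {α₁} λ s′ → skew-disjoint {γ₁} {β₁} {α₁} s′ s

  link-trans : Link p t
  link-trans = record
    { target-isPair = Link.target-isPair L′
    ; grows = λ i → ≤-trans (Link.grows L i) (Link.grows L′ i)
    ; shrinks = λ i → ≤-trans (Link.shrinks L′ i) (Link.shrinks L i)
    }

  private
    h = spliced
    g = spliced⁻¹

    outer-a : ∀ {x} → Outer p q x → Outer p t x
    outer-a = skew-weakenʳ {α₂} {β₂} {γ₂} (Link.shrinks L′)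
    outer-b : ∀ {x} → Outer q t x → Outer p t x
    outer-b = skew-weakenˡ {α₂} {β₂} {γ₂} (Link.shrinks L)
    inner-a : ∀ {y} → Inner p q y → Inner p t y
    inner-a = skew-weakenˡ {γ₁} {β₁} {α₁} (Link.grows L′)
    inner-b : ∀ {y} → Inner q t y → Inner p t y
    inner-b = skew-weakenʳ {γ₁} {β₁} {α₁} (Link.grows L)

    outer-split : ∀ {x} → Outer p t x → Outer q t x ⊎ Outer p q x
    outer-split = skew-split {α₂} β₂ {γ₂}
    inner-split : ∀ {y} → Inner p t y → Inner p q y ⊎ Inner q t y
    inner-split = skew-split {γ₁} β₁ {α₁}

    outer-order : ∀ {x y} → Outer p q x → Outer q t y → row x ≤ row y → ¬ (col x ≤ col y)
    outer-order = no-outer-before-inner {α₂} {β₂} {γ₂} pβ₂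
    inner-order : ∀ {x y} → Inner q t x → Inner p q y → row x ≤ row y → ¬ (col x ≤ col y)
    inner-order = no-outer-before-inner {γ₁} {β₁} {α₁} pβ₁

    to-a : ∀ {x} → Outer p q x → Inner p q (h x)
    to-a s = subst (Inner p q) (sym (spliced-a s)) (a.to s)
    to-b : ∀ {x} → Outer q t x → Inner q t (h x)
    to-b s = subst (Inner q t) (sym (spliced-b s)) (b.to s)
    from-a : ∀ {y} → Inner p q y → Outer p q (g y)
    from-a s = subst (Outer p q) (sym (spliced⁻¹-a s)) (a.from s)
    from-b : ∀ {y} → Inner q t y → Outer q t (g y)
    from-b s = subst (Outer q t) (sym (spliced⁻¹-b s)) (b.from s)

    to : ∀ {x} → Outer p t x → Inner p t (h x)
    to s with outer-split s
    ... | inj₁ s′ = inner-b (to-b s′)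
    ... | inj₂ s′ = inner-a (to-a s′)
    from : ∀ {y} → Inner p t y → Outer p t (g y)
    from s with inner-split s
    ... | inj₁ s′ = outer-a (from-a s′)
    ... | inj₂ s′ = outer-b (from-b s′)
    g∘h : ∀ {x} → Outer p t x → g (h x) ≡ x
    g∘h s with outer-split s
    ... | inj₁ s′ = trans (spliced⁻¹-b (to-b s′)) (trans (cong gb (spliced-b s′)) (b.g∘h s′))
    ... | inj₂ s′ = trans (spliced⁻¹-a (to-a s′)) (trans (cong ga (spliced-a s′)) (a.g∘h s′))
    h∘g : ∀ {y} → Inner p t y → h (g y) ≡ y
    h∘g s with inner-split s
    ... | inj₁ s′ = trans (spliced-a (from-a s′)) (trans (cong ha (spliced⁻¹-a s′)) (a.h∘g s′))
    ... | inj₂ s′ = trans (spliced-b (from-b s′)) (trans (cong hb (spliced⁻¹-b s′)) (b.h∘g s′))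

  module _ (rule : ∀ {x} → Outer p q x → Rule r x (ha x)) (¬rule : ∀ {x} → Outer q t x → ¬ Rule r x (hb x)) where

    private
      rule′ : ∀ {x} → Outer p q x → Rule r x (h x)
      rule′ {x} s = subst (Rule r x) (sym (spliced-a s)) (rule s)
      ¬rule′ : ∀ {x} → Outer q t x → row (h x) + col x < r + row x
      ¬rule′ {x} s = ≰⇒> (subst (λ y → ¬ Rule r x y) (sym (spliced-b s)) (¬rule s))

      h-twists : Twisting (Outer p t) h
      h-twists = record { right = R ; down = D }
        where
        R : ∀ {i c} → Outer p t (i , c) → Outer p t (i , suc c) →
          col (h (i , suc c)) < col (h (i , c)) × row (h (i , c)) ≤ row (h (i , suc c))
        R {i} {c} s s′ with outer-split s | outer-split s′
        ... | inj₁ u | inj₁ u′ = subst₂ (λ y y′ → col y′ < col y × row y ≤ row y′) (sym (spliced-b u)) (sym (spliced-b u′))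
          (Twisting.right b.h-twists u u′)
        ... | inj₂ u | inj₂ u′ = subst₂ (λ y y′ → col y′ < col y × row y ≤ row y′) (sym (spliced-a u)) (sym (spliced-a u′))
          (Twisting.right a.h-twists u u′)
        ... | inj₂ u | inj₁ u′ = ⊥-elim (outer-order u u′ ≤-refl (n≤1+n c))
        -- The left box violates the rule and the right one obeys it: row (h left) + c < r + i ≤ row
        -- (h right) + c + 1. This gives the rows, and the nesting of the target shapes then forces
        -- the columns.
        ... | inj₁ u | inj₂ u′ = ≰⇒> (inner-order (to-b u) (to-a u′) rows) , rows
          where
          rows : row (h (i , c)) ≤ row (h (i , suc c))
          rows = +-cancelʳ-≤ c _ _ (s≤s⁻¹ (≤-trans (≤-trans (¬rule′ u) (rule′ u′)) (≤-reflexive (+-suc _ c))))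
        D : ∀ {i c} → Outer p t (i , c) → Outer p t (suc i , c) →
          row (h (i , c)) < row (h (suc i , c)) × col (h (suc i , c)) ≤ col (h (i , c))
        D {i} {c} s s′ with outer-split s | outer-split s′
        ... | inj₁ u | inj₁ u′ = subst₂ (λ y y′ → row y < row y′ × col y′ ≤ col y) (sym (spliced-b u)) (sym (spliced-b u′))
          (Twisting.down b.h-twists u u′)
        ... | inj₂ u | inj₂ u′ = subst₂ (λ y y′ → row y < row y′ × col y′ ≤ col y) (sym (spliced-a u)) (sym (spliced-a u′))
          (Twisting.down a.h-twists u u′)
        ... | inj₂ u | inj₁ u′ = ⊥-elim (outer-order u u′ (n≤1+n i) ≤-refl)
        -- Both boxes have column `c`, so the same chain of inequalities now gives a strict
        -- comparison of rows.
        ... | inj₁ u | inj₂ u′ = rows , ≮⇒≥ (λ l → inner-order (to-b u) (to-a u′) (<⇒≤ rows) (<⇒≤ l))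
          where
          rows : row (h (i , c)) < row (h (suc i , c))
          rows = +-cancelʳ-< c _ _ (<-≤-trans (¬rule′ u) (≤-trans (+-monoʳ-≤ r (n≤1+n i)) (rule′ u′)))

      module _ (pα₂ : IsPartition α₂) where

        convex = inSkew-convex pα₂ pγ₂

        -- On the inverse side the rules do not compare the rows of preimages directly; they only
        -- place the two preimages on strictly ordered diagonals.
        drop : ∀ {y y′} → Inner p q y → Inner q t y′ → row y ≤ row y′ →
          row (g y) + col (g y′) < row (g y′) + col (g y)
        drop {y} {y′} u u′ l = rule-trade {r}
          (subst (λ z → Rule r (g y) z) (h∘g (inner-a u)) (rule′ (from-a u)))
          (subst (λ z → row z + col (g y′) < r + row (g y′)) (h∘g (inner-b u′)) (¬rule′ (from-b u′)))
          l

        g-twists : Twisting (Inner p t) g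
        g-twists = record { right = R ; down = D }
          where
          R : ∀ {i c} → Inner p t (i , c) → Inner p t (i , suc c) →
            col (g (i , suc c)) < col (g (i , c)) × row (g (i , c)) ≤ row (g (i , suc c))
          R {i} {c} s s′ with inner-split s | inner-split s′
          ... | inj₁ u | inj₁ u′ = subst₂ (λ y y′ → col y′ < col y × row y ≤ row y′) (sym (spliced⁻¹-a u)) (sym (spliced⁻¹-a u′))
            (Twisting.right a.g-twists u u′)
          ... | inj₂ u | inj₂ u′ = subst₂ (λ y y′ → col y′ < col y × row y ≤ row y′) (sym (spliced⁻¹-b u)) (sym (spliced⁻¹-b u′))
            (Twisting.right b.g-twists u u′)
          ... | inj₂ u | inj₁ u′ = ⊥-elim (inner-order u u′ ≤-refl (n≤1+n c))
          -- If `g (i , suc c)` were strictly above `g (i , c)`, the diagonals would put it weakly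
          -- to the left as well. The twisting of `h` would then place (i , suc c) strictly above (i
          -- , c), although they share a row.
          ... | inj₁ u | inj₂ u′ = ≰⇒> (outer-order (from-a u) (from-b u′) rows) , rows
            where
            rows : row (g (i , c)) ≤ row (g (i , suc c))
            rows = ≮⇒≥ λ l → <-irrefl refl (subst₂ (λ y y′ → row y < row y′) (h∘g s′) (h∘g s)
              (twist-row< convex h-twists (from s′) (from s) l (trade-col (drop u u′ ≤-refl) (<⇒≤ l))))
          D : ∀ {i c} → Inner p t (i , c) → Inner p t (suc i , c) →
            row (g (i , c)) < row (g (suc i , c)) × col (g (suc i , c)) ≤ col (g (i , c))
          D {i} {c} s s′ with inner-split s | inner-split s′
          ... | inj₁ u | inj₁ u′ = subst₂ (λ y y′ → row y < row y′ × col y′ ≤ col y) (sym (spliced⁻¹-a u)) (sym (spliced⁻¹-a u′))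
            (Twisting.down a.g-twists u u′)
          ... | inj₂ u | inj₂ u′ = subst₂ (λ y y′ → row y < row y′ × col y′ ≤ col y) (sym (spliced⁻¹-b u)) (sym (spliced⁻¹-b u′))
            (Twisting.down b.g-twists u u′)
          ... | inj₂ u | inj₁ u′ = ⊥-elim (inner-order u u′ (n≤1+n i) ≤-refl)
          ... | inj₁ u | inj₂ u′ = rows , ≮⇒≥ (λ l → outer-order (from-a u) (from-b u′) (<⇒≤ rows) (<⇒≤ l))
            where
            rows : row (g (i , c)) < row (g (suc i , c))
            rows = ≰⇒> λ l → <-irrefl refl (subst₂ (λ y y′ → row y ≤ row y′) (h∘g s′) (h∘g s)
              (twist-row≤ convex h-twists (from s′) (from s) l (trade-col (drop u u′ (n≤1+n i)) l)))

    splice-picture : IsPartition α₂ → Picture (Outer p t) (Inner p t) spliced spliced⁻¹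
    splice-picture pα₂ = record
      { to = to ; from = from ; g∘h = g∘h ; h∘g = h∘g ; h-twists = h-twists ; g-twists = g-twists pα₂ }

-- Splitting a picture

twisting-restrict : ∀ {A A′ h} → (∀ {x} → A′ x → A x) → Twisting A h → Twisting A′ h
twisting-restrict sub tw = record
  { right = λ s s′ → Twisting.right tw (sub s) (sub s′) ; down = λ s s′ → Twisting.down tw (sub s) (sub s′) }

picture-restrict : ∀ {A B A′ B′ h g} → (∀ {x} → A′ x → A x) → (∀ {y} → B′ y → B y) →
  (∀ {x} → A′ x → B′ (h x)) → (∀ {y} → B′ y → A′ (g y)) → Picture A B h g → Picture A′ B′ h g
picture-restrict subA subB to from P = record
  { to = to ; from = from ; g∘h = λ s → Picture.g∘h P (subA s) ; h∘g = λ s → Picture.h∘g P (subB s)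
  ; h-twists = twisting-restrict subA (Picture.h-twists P) ; g-twists = twisting-restrict subB (Picture.g-twists P) }

-- Both halves keep the original `h` and `g`, so gluing them gives back the same map on the boxes of
-- the source shape.
record Splitting (r : ℕ) (p t : Pair) (h g : Box → Box) : Set where
  field
    middle : Pair
    first : Link p middle
    second : Link middle t
    first-picture : Picture (Outer p middle) (Inner p middle) h g
    second-picture : Picture (Outer middle t) (Inner middle t) h g
    first-rule : ∀ {x} → Outer p middle x → Rule r x (h x)
    second-rule : ∀ {x} → Outer middle t x → ¬ Rule r x (h x)

-- The boxes obeying the row rule form the outer part of α₂/γ₂ and the inner part of γ₁/α₁.
split-picture : ∀ r {p t h g} → IsPair p → Link p t → Picture (Outer p t) (Inner p t) h g → Splitting r p t h g
split-picture r {p@(α₁ , α₂)} {t@(γ₁ , γ₂)} {h} {g} (pα₁ , pα₂) L P = record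
  { middle = β₁ , β₂
  ; first = record { target-isPair = (_ , pβ₁) , (_ , pβ₂) ; grows = α₁⊑β₁ ; shrinks = β₂⊑α₂ }
  ; second = record { target-isPair = pγ₁ , pγ₂ ; grows = β₁⊑γ₁ ; shrinks = γ₂⊑β₂ }
  ; first-picture = picture-restrict outer-a inner-a
      (λ s → rule⇒inner (to (outer-a s)) (subst (λ z → Rule r z (h _)) (sym (g∘h (outer-a s))) (outer⇒rule s)))
      (λ s → rule⇒outer (from (inner-a s)) (subst (Rule r (g _)) (sym (h∘g (inner-a s))) (inner⇒rule s))) P
  ; second-picture = picture-restrict outer-b inner-b
      (λ s → ¬rule⇒inner (to (outer-b s)) (λ k → outer⇒¬rule s (subst (λ z → Rule r z (h _)) (g∘h (outer-b s)) k)))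
      (λ s → ¬rule⇒outer (from (inner-b s)) (λ k → inner⇒¬rule s (subst (Rule r (g _)) (h∘g (inner-b s)) k))) P
  ; first-rule = outer⇒rule
  ; second-rule = outer⇒¬rule
  }
  where
  open Picture P
  pγ₁ = proj₁ (Link.target-isPair L)
  pγ₂ = proj₂ (Link.target-isPair L)

  -- The smaller partition is included so that the boxes form an ideal of the whole larger one.
  -- Beyond it, `D₂` collects the source boxes violating the rule and `D₁` the target boxes whose
  -- preimages obey it.
  D₂ D₁ : ℕ → ℕ → Set
  D₂ i c = c ≤ at γ₂ i ⊎ ¬ Rule r (suc i , c) (h (suc i , c))
  D₁ i c = c ≤ at α₁ i ⊎ Rule r (g (suc i , c)) (suc i , c)

  D₂? : ∀ i c → Dec (D₂ i c)
  D₂? i c = (c ≤? at γ₂ i) ⊎-dec ¬? (rule? r (suc i , c) (h (suc i , c)))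
  D₁? : ∀ i c → Dec (D₁ i c)
  D₁? i c = (c ≤? at α₁ i) ⊎-dec rule? r (g (suc i , c)) (suc i , c)

  left₂ : ∀ i c → 1 ≤ c → suc c ≤ at α₂ i → D₂ i (suc c) → D₂ i c
  left₂ i c 1≤c l (inj₁ k) = inj₁ (<⇒≤ k)
  left₂ i c 1≤c l (inj₂ ¬k) with c ≤? at γ₂ i
  ... | yes m = inj₁ m
  -- The rule passes from a box to its right neighbour, since neither the image row nor the column
  -- decreases; its failure therefore passes to the left.
  ... | no ¬m = inj₂ λ k → ¬k (≤-trans k (+-mono-≤ (proj₂ (Twisting.right h-twists
    (s≤s z≤n , ≰⇒> ¬m , <⇒≤ l) (s≤s z≤n , m<n⇒m<1+n (≰⇒> ¬m) , l))) (n≤1+n c)))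
  up₂ : ∀ i c → 1 ≤ c → c ≤ at α₂ (suc i) → D₂ (suc i) c → D₂ i c
  up₂ i c 1≤c l (inj₁ k) = inj₁ (≤-trans k (at-antitone pγ₂ (n≤1+n i)))
  up₂ i c 1≤c l (inj₂ ¬k) with c ≤? at γ₂ i
  ... | yes m = inj₁ m
  -- A step down adds one to the left side of the rule and at least one to the image row, so failure
  -- of the rule passes upwards.
  ... | no ¬m = inj₂ λ k → ¬k (≤-trans (≤-trans (≤-reflexive (+-suc r (suc i))) (s≤s k)) (+-monoˡ-≤ c (proj₁ (Twisting.down h-twists
    (s≤s z≤n , ≰⇒> ¬m , ≤-trans l (at-antitone pα₂ (n≤1+n i)))
    (s≤s z≤n , ≤-<-trans (at-antitone pγ₂ (n≤1+n i)) (≰⇒> ¬m) , l)))))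

  left₁ : ∀ i c → 1 ≤ c → suc c ≤ at γ₁ i → D₁ i (suc c) → D₁ i c
  left₁ i c 1≤c l (inj₁ k) = inj₁ (<⇒≤ k)
  left₁ i c 1≤c l (inj₂ k) with c ≤? at α₁ i
  ... | yes m = inj₁ m
  ... | no ¬m = let (cs , rs) = Twisting.right g-twists (s≤s z≤n , ≰⇒> ¬m , <⇒≤ l) (s≤s z≤n , m<n⇒m<1+n (≰⇒> ¬m) , l)
    in inj₂ (≤-trans (+-monoʳ-≤ r rs) (≤-trans k (+-monoʳ-≤ (suc i) (<⇒≤ cs))))
  up₁ : ∀ i c → 1 ≤ c → c ≤ at γ₁ (suc i) → D₁ (suc i) c → D₁ i c
  up₁ i c 1≤c l (inj₁ k) = inj₁ (≤-trans k (at-antitone pα₁ (n≤1+n i)))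
  up₁ i c 1≤c l (inj₂ k) with c ≤? at α₁ i
  ... | yes m = inj₁ m
  -- Going up loses one row in the target, but the preimage loses at least one row and no column, so
  -- the rule persists.
  ... | no ¬m = let (rs , cs) = Twisting.down g-twists (s≤s z≤n , ≰⇒> ¬m , ≤-trans l (at-antitone pγ₁ (n≤1+n i)))
                                  (s≤s z≤n , ≤-<-trans (at-antitone pα₁ (n≤1+n i)) (≰⇒> ¬m) , l)
    in inj₂ (s≤s⁻¹ (≤-trans (≤-trans (≤-reflexive (sym (+-suc r _))) (+-monoʳ-≤ r rs)) (≤-trans k (+-monoʳ-≤ (suc (suc i)) cs))))

  ideal₂ = ideal-partition (proj₂ pα₂) D₂ D₂? left₂ up₂
  ideal₁ = ideal-partition (proj₂ pγ₁) D₁ D₁? left₁ up₁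
  β₂ = proj₁ ideal₂
  β₁ = proj₁ ideal₁
  pβ₂ = proj₁ (proj₂ ideal₂)
  pβ₁ = proj₁ (proj₂ ideal₁)
  β₂⁻ = proj₁ (proj₂ (proj₂ ideal₂))
  β₂⁺ = proj₂ (proj₂ (proj₂ ideal₂))
  β₁⁻ = proj₁ (proj₂ (proj₂ ideal₁))
  β₁⁺ = proj₂ (proj₂ (proj₂ ideal₁))

  β₂⊑α₂ : β₂ ⊑ α₂
  β₂⊑α₂ = ⊑-from-boxes β₂ α₂ λ i c 1≤c l → proj₁ (β₂⁻ i c 1≤c l)
  γ₂⊑β₂ : γ₂ ⊑ β₂
  γ₂⊑β₂ = ⊑-from-boxes γ₂ β₂ λ i c 1≤c l → β₂⁺ i c 1≤c (≤-trans l (Link.shrinks L i)) (inj₁ l)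
  β₁⊑γ₁ : β₁ ⊑ γ₁
  β₁⊑γ₁ = ⊑-from-boxes β₁ γ₁ λ i c 1≤c l → proj₁ (β₁⁻ i c 1≤c l)
  α₁⊑β₁ : α₁ ⊑ β₁
  α₁⊑β₁ = ⊑-from-boxes α₁ β₁ λ i c 1≤c l → β₁⁺ i c 1≤c (≤-trans l (Link.grows L i)) (inj₁ l)

  outer-a : ∀ {x} → InSkew α₂ β₂ x → InSkew α₂ γ₂ x
  outer-a = skew-weakenʳ {α₂} {β₂} {γ₂} γ₂⊑β₂
  outer-b : ∀ {x} → InSkew β₂ γ₂ x → InSkew α₂ γ₂ x
  outer-b = skew-weakenˡ {α₂} {β₂} {γ₂} β₂⊑α₂
  inner-a : ∀ {y} → InSkew β₁ α₁ y → InSkew γ₁ α₁ y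
  inner-a = skew-weakenˡ {γ₁} {β₁} {α₁} β₁⊑γ₁
  inner-b : ∀ {y} → InSkew γ₁ β₁ y → InSkew γ₁ α₁ y
  inner-b = skew-weakenʳ {γ₁} {β₁} {α₁} α₁⊑β₁

  outer⇒rule : ∀ {x} → InSkew α₂ β₂ x → Rule r x (h x)
  outer⇒rule {suc i , c} (_ , q , s) = decidable-stable (rule? r (suc i , c) (h (suc i , c)))
    λ ¬k → <⇒≱ q (β₂⁺ i c (≤-trans (s≤s z≤n) q) s (inj₂ ¬k))
  outer⇒¬rule : ∀ {x} → InSkew β₂ γ₂ x → ¬ Rule r x (h x)
  outer⇒¬rule {suc i , c} (_ , q , s) with proj₂ (β₂⁻ i c (≤-trans (s≤s z≤n) q) s)
  ... | inj₁ l = ⊥-elim (<⇒≱ q l)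
  ... | inj₂ ¬k = ¬k
  rule⇒outer : ∀ {x} → InSkew α₂ γ₂ x → Rule r x (h x) → InSkew α₂ β₂ x
  rule⇒outer s k with skew-split {α₂} β₂ {γ₂} s
  ... | inj₁ s′ = ⊥-elim (outer⇒¬rule s′ k)
  ... | inj₂ s′ = s′
  ¬rule⇒outer : ∀ {x} → InSkew α₂ γ₂ x → ¬ Rule r x (h x) → InSkew β₂ γ₂ x
  ¬rule⇒outer s ¬k with skew-split {α₂} β₂ {γ₂} s
  ... | inj₁ s′ = s′
  ... | inj₂ s′ = ⊥-elim (¬k (outer⇒rule s′))

  inner⇒rule : ∀ {y} → InSkew β₁ α₁ y → Rule r (g y) y
  inner⇒rule {suc i , c} (_ , q , s) with proj₂ (β₁⁻ i c (≤-trans (s≤s z≤n) q) s)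
  ... | inj₁ l = ⊥-elim (<⇒≱ q l)
  ... | inj₂ k = k
  inner⇒¬rule : ∀ {y} → InSkew γ₁ β₁ y → ¬ Rule r (g y) y
  inner⇒¬rule {suc i , c} (_ , q , s) k = <⇒≱ q (β₁⁺ i c (≤-trans (s≤s z≤n) q) s (inj₂ k))
  rule⇒inner : ∀ {y} → InSkew γ₁ α₁ y → Rule r (g y) y → InSkew β₁ α₁ y
  rule⇒inner s k with skew-split {γ₁} β₁ {α₁} s
  ... | inj₁ s′ = s′
  ... | inj₂ s′ = ⊥-elim (inner⇒¬rule s′ k)
  ¬rule⇒inner : ∀ {y} → InSkew γ₁ α₁ y → ¬ Rule r (g y) y → InSkew γ₁ β₁ y
  ¬rule⇒inner s ¬k with skew-split {γ₁} β₁ {α₁} s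
  ... | inj₁ s′ = ⊥-elim (¬k (inner⇒rule s′))
  ... | inj₂ s′ = s′

-- Factoring arrows

ruleArrows reverseArrows : ℕ → Pair → List Arrow
ruleArrows r p = filterᵇ (satisfiesRowRule r p) (arrowsFrom₊ p)
reverseArrows r p = filterᵇ (satisfiesReverseRowRule r p) (arrowsFrom₊ p)

factorisations : ℕ → Pair → List (Arrow × Arrow)
factorisations r p = concatMap (λ a → map (a ,_) (reverseArrows r (target a))) (ruleArrows r p)

-- In the reading order of the combined shape, the labels of the two factors may interleave. The
-- glued box map is therefore read off afresh instead of joining the two tableaux as lists.
compose : Pair → Arrow × Arrow → Arrow
compose p (a , b) = arrow t (map (splice (proj₂ q) (proj₂ t) (boxMap q b) (boxMap p a)) (labels p t))
  where
  q = target a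
  t = target b

tableau-≡ : ∀ {q} {a : Arrow} {t} → target a ≡ q → tableau a ≡ t → a ≡ arrow q t
tableau-≡ refl refl = refl

∈-factorisations⁻ : ∀ r p {a b} → (a , b) ∈ factorisations r p → a ∈ ruleArrows r p × b ∈ reverseArrows r (target a)
∈-factorisations⁻ r p m with ∈-concatMap-elim (λ a → map (a ,_) (reverseArrows r (target a))) {ruleArrows r p} m
... | a , a∈ , m′ with ∈-map⁻ (a ,_) m′
... | b , b∈ , refl = a∈ , b∈

∈-factorisations⁺ : ∀ r p {a b} → a ∈ ruleArrows r p → b ∈ reverseArrows r (target a) → (a , b) ∈ factorisations r p
∈-factorisations⁺ r p {a} m n = ∈-concatMap-intro (λ a → map (a ,_) (reverseArrows r (target a))) m (∈-map⁺ (a ,_) n)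

Unique-factorisations : ∀ r p → Unique (factorisations r p)
Unique-factorisations r p = Unique-concatMap⁺ (λ a → map (a ,_) (reverseArrows r (target a)))
  (Unique-filterᵇ⁺ (satisfiesRowRule r p) (Unique-arrowsFrom₊ p))
  (λ {a} _ → Unique.map⁺ (cong proj₂) (Unique-filterᵇ⁺ (satisfiesReverseRowRule r (target a)) (Unique-arrowsFrom₊ (target a))))
  (λ {a} {a′} _ _ m m′ → let (_ , _ , e) = ∈-map⁻ (a ,_) m ; (_ , _ , e′) = ∈-map⁻ (a′ ,_) m′ in
     cong proj₁ (trans (sym e) e′))

module Factored (r : ℕ) {p : Pair} (pp : IsPair p) {a b : Arrow} (m : (a , b) ∈ factorisations r p) where

  q t : Pair
  q = target a
  t = target b

  private
    a∈r = proj₁ (∈-factorisations⁻ r p m)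
    b∈r = proj₂ (∈-factorisations⁻ r p m)

  a∈ : a ∈ arrowsFrom₊ p
  a∈ = proj₁ (∈-filterᵇ⁻ (satisfiesRowRule r p) (arrowsFrom₊ p) a∈r)

  b∈ : b ∈ arrowsFrom₊ q
  b∈ = proj₁ (∈-filterᵇ⁻ (satisfiesReverseRowRule r q) (arrowsFrom₊ q) b∈r)

  ha hb : Box → Box
  ha = boxMap p a
  hb = boxMap q b

  L : Link p q
  L = proj₁ (∈-arrowsFrom₊⁻ pp a∈)

  L′ : Link q t
  L′ = proj₁ (∈-arrowsFrom₊⁻ (Link.target-isPair L) b∈)

  ga gb : Box → Box
  ga = proj₁ (proj₂ (∈-arrowsFrom₊⁻ pp a∈))
  gb = proj₁ (proj₂ (∈-arrowsFrom₊⁻ (Link.target-isPair L) b∈))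

  Pa : Picture (Outer p q) (Inner p q) ha ga
  Pa = proj₂ (proj₂ (∈-arrowsFrom₊⁻ pp a∈))

  Pb : Picture (Outer q t) (Inner q t) hb gb
  Pb = proj₂ (proj₂ (∈-arrowsFrom₊⁻ (Link.target-isPair L) b∈))

  a≡ : a ≡ arrow q (map ha (labels p q))
  a≡ = tableau-≡ refl (map-boxMap {p} a∈)

  b≡ : b ≡ arrow t (map hb (labels q t))
  b≡ = tableau-≡ refl (map-boxMap {q} b∈)

  rule : ∀ {x} → Outer p q x → Rule r x (ha x)
  rule = rowRule⁻ r p q ha (subst (T ∘ satisfiesRowRule r p) a≡ (proj₂ (∈-filterᵇ⁻ (satisfiesRowRule r p) (arrowsFrom₊ p) a∈r)))

  ¬rule : ∀ {x} → Outer q t x → ¬ Rule r x (hb x)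
  ¬rule = reverseRowRule⁻ r q t hb
    (subst (T ∘ satisfiesReverseRowRule r q) b≡ (proj₂ (∈-filterᵇ⁻ (satisfiesReverseRowRule r q) (arrowsFrom₊ q) b∈r)))

  h : Box → Box
  h = splice (proj₂ q) (proj₂ t) hb ha

  h-a : ∀ {x} → Outer p q x → h x ≡ ha x
  h-a = spliced-a r L L′ Pa Pb

  h-b : ∀ {x} → Outer q t x → h x ≡ hb x
  h-b = spliced-b r L L′ Pa Pb

  a≡h : a ≡ arrow q (map h (labels p q))
  a≡h = trans a≡ (cong (arrow q) (map-cong-local (All.tabulate λ x∈ → sym (h-a (∈-rlBoxes⁻ (proj₂ p) (proj₂ q) x∈)))))

  b≡h : b ≡ arrow t (map h (labels q t))
  b≡h = trans b≡ (cong (arrow t) (map-cong-local (All.tabulate λ x∈ → sym (h-b (∈-rlBoxes⁻ (proj₂ q) (proj₂ t) x∈)))))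

  compose∈ : compose p (a , b) ∈ arrowsFrom₊ p
  compose∈ = ∈-arrowsFrom₊⁺ pp (link-trans r L L′ Pa Pb) (splice-picture r L L′ Pa Pb rule ¬rule (proj₂ pp))

  -- Lets the row lengths of the middle first partition be recovered from images under `h`.
  last-box : ∀ i → at (proj₁ q) i ≤ at (proj₁ p) i ⊎
    ∃ λ x → Outer p q x × h x ≡ (suc i , at (proj₁ q) i)
  last-box i with at (proj₁ q) i ≤? at (proj₁ p) i
  ... | yes l = inj₁ l
  ... | no ¬l = let y = (s≤s z≤n , ≰⇒> ¬l , ≤-refl) ; x = Picture.from Pa y in
    inj₂ (_ , x , trans (h-a x) (Picture.h∘g Pa y))

-- Uniqueness of the factorisation

module _ (r : ℕ) {p : Pair} (pp : IsPair p) {a b a′ b′ : Arrow}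
  (m : (a , b) ∈ factorisations r p) (m′ : (a′ , b′) ∈ factorisations r p) where

  private
    module F = Factored r pp m
    module F′ = Factored r pp m′

  module _ (t≡ : F.t ≡ F′.t) (h≡ : ∀ {x} → Outer p F.t x → F.h x ≡ F′.h x) where

    -- A box in only the first of the two cuts would belong to the reverse factor on one side and to
    -- the row-rule factor on the other, yet whether it obeys the rule depends only on its common
    -- image.
    agree⇒⊑₂ : proj₂ F.q ⊑ proj₂ F′.q
    agree⇒⊑₂ = ⊑-from-boxes (proj₂ F.q) (proj₂ F′.q) go
      where
      go : ∀ i c → 1 ≤ c → c ≤ at (proj₂ F.q) i → c ≤ at (proj₂ F′.q) i
      go i c 1≤c l = ≮⇒≥ λ q′<c →
        let t′≤ = Link.shrinks F′.L′ i
            s′ : Outer p F′.q (suc i , c)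
            s′ = s≤s z≤n , q′<c , ≤-trans l (Link.shrinks F.L i)
            s : Outer F.q F.t (suc i , c)
            s = s≤s z≤n , subst (λ t → at (proj₂ t) i < c) (sym t≡) (≤-<-trans t′≤ q′<c) , l
            k : F.h (suc i , c) ≡ F′.h (suc i , c)
            k = h≡ (skew-weakenˡ {proj₂ p} {proj₂ F.q} {proj₂ F.t} (Link.shrinks F.L) s)
        in F.¬rule s (subst (Rule r (suc i , c)) (trans (sym (F′.h-a s′)) (trans (sym k) (F.h-b s))) (F′.rule s′))

    -- Once the cut of the source is known, the cut of the target is the image of its outer part
    -- under the common map.
    agree⇒⊑₁ : proj₂ F.q ≡ proj₂ F′.q → proj₁ F.q ⊑ proj₁ F′.q
    agree⇒⊑₁ e i with F.last-box i
    ... | inj₁ l = ≤-trans l (Link.grows F′.L i)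
    ... | inj₂ (x , s , k) = proj₂ (proj₂ (subst (Inner p F′.q)
      (trans (sym (F′.h-a s′)) (trans (sym (h≡ (skew-weakenʳ {proj₂ p} {proj₂ F.q} {proj₂ F.t} (Link.shrinks F.L′) s))) k))
      (Picture.to F′.Pa s′)))
      where
      s′ : Outer p F′.q x
      s′ = subst (λ β → InSkew (proj₂ p) β x) e s

compose-injective : ∀ r {p} → IsPair p → ∀ {ab ab′} → ab ∈ factorisations r p → ab′ ∈ factorisations r p →
  compose p ab ≡ compose p ab′ → ab ≡ ab′
compose-injective r {p} pp {a , b} {a′ , b′} m m′ e = cong₂ _,_
  (trans F.a≡h (trans (cong₂ arrow q≡ (trans (map-cong-local (All.tabulate λ x∈ → h≡ (outer-a (∈-rlBoxes⁻ (proj₂ p) (proj₂ F.q) x∈))))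
     (cong (λ q → map F′.h (labels p q)) q≡))) (sym F′.a≡h)))
  (trans F.b≡h (trans (cong₂ arrow t≡ (trans (map-cong-local (All.tabulate λ x∈ → h≡ (outer-b (∈-rlBoxes⁻ (proj₂ F.q) (proj₂ F.t) x∈))))
     (cong₂ (λ q t → map F′.h (labels q t)) q≡ t≡))) (sym F′.b≡h)))
  where
  module F = Factored r pp m
  module F′ = Factored r pp m′
  t≡ : F.t ≡ F′.t
  t≡ = cong target e
  outer-a : ∀ {x} → Outer p F.q x → Outer p F.t x
  outer-a = skew-weakenʳ {proj₂ p} {proj₂ F.q} {proj₂ F.t} (Link.shrinks F.L′)
  outer-b : ∀ {x} → Outer F.q F.t x → Outer p F.t x
  outer-b = skew-weakenˡ {proj₂ p} {proj₂ F.q} {proj₂ F.t} (Link.shrinks F.L)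
  h≡ : ∀ {x} → Outer p F.t x → F.h x ≡ F′.h x
  h≡ s = map-≡⇒pointwise (labels p F.t)
    (trans (cong tableau e) (cong (λ t → map F′.h (labels p t)) (sym t≡))) (∈-rlBoxes⁺ (proj₂ p) (proj₂ F.t) s)
  h≡′ : ∀ {x} → Outer p F′.t x → F′.h x ≡ F.h x
  h≡′ {x} s = sym (h≡ (subst (λ t → Outer p t x) (sym t≡) s))
  isPair = Link.target-isPair F.L
  isPair′ = Link.target-isPair F′.L
  q₂≡ : proj₂ F.q ≡ proj₂ F′.q
  q₂≡ = ⊑-antisym (proj₂ (proj₂ isPair)) (proj₂ (proj₂ isPair′)) (agree⇒⊑₂ r pp m m′ t≡ h≡) (agree⇒⊑₂ r pp m′ m (sym t≡) h≡′)
  q₁≡ : proj₁ F.q ≡ proj₁ F′.q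
  q₁≡ = ⊑-antisym (proj₂ (proj₁ isPair)) (proj₂ (proj₁ isPair′))
    (agree⇒⊑₁ r pp m m′ t≡ h≡ q₂≡) (agree⇒⊑₁ r pp m′ m (sym t≡) h≡′ (sym q₂≡))
  q≡ : F.q ≡ F′.q
  q≡ = cong₂ _,_ q₁≡ q₂≡

compose-surjective : ∀ r {p} → IsPair p → ∀ {c} → c ∈ arrowsFrom₊ p → ∃ λ ab → ab ∈ factorisations r p × c ≡ compose p ab
compose-surjective r {p} pp {c} c∈ = (a , b) , m ,
  tableau-≡ refl (trans (map-boxMap {p} c∈) (map-cong-local (All.tabulate λ x∈ → agree (∈-rlBoxes⁻ (proj₂ p) (proj₂ t) x∈))))
  where
  t = target c
  h = boxMap p c
  L = proj₁ (∈-arrowsFrom₊⁻ pp c∈)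
  P = proj₂ (proj₂ (∈-arrowsFrom₊⁻ pp c∈))
  open Splitting (split-picture r pp L P)
  q = middle
  a = arrow q (map h (labels p q))
  b = arrow t (map h (labels q t))
  a∈ : a ∈ ruleArrows r p
  a∈ = ∈-filterᵇ⁺ (satisfiesRowRule r p) (∈-arrowsFrom₊⁺ pp first first-picture) (rowRule⁺ r p q h first-rule)
  b∈ : b ∈ reverseArrows r q
  b∈ = ∈-filterᵇ⁺ (satisfiesReverseRowRule r q) (∈-arrowsFrom₊⁺ (Link.target-isPair first) second second-picture)
    (reverseRowRule⁺ r q t h second-rule)
  m : (a , b) ∈ factorisations r p
  m = ∈-factorisations⁺ r p a∈ b∈
  module F = Factored r pp m
  agree : ∀ {x} → Outer p t x → h x ≡ F.h x
  agree {x} s with skew-split {proj₂ p} (proj₂ q) {proj₂ t} s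
  ... | inj₁ s′ = trans (map-≡⇒pointwise (labels q t) (cong tableau F.b≡) (∈-rlBoxes⁺ (proj₂ q) (proj₂ t) s′)) (sym (F.h-b s′))
  ... | inj₂ s′ = trans (map-≡⇒pointwise (labels p q) (cong tableau F.a≡) (∈-rlBoxes⁺ (proj₂ p) (proj₂ q) s′)) (sym (F.h-a s′))

factorisations↭arrows : ∀ r {p} → IsPair p → map (compose p) (factorisations r p) ↭ arrowsFrom₊ p
factorisations↭arrows r {p} pp = unique-set⇒↭
  (Unique-map⁺ (compose p) (Unique-factorisations r p) (compose-injective r pp))
  (Unique-arrowsFrom₊ p)
  (λ n → let (ab , m , e) = ∈-map⁻ (compose p) n in subst (_∈ arrowsFrom₊ p) (sym e) (Factored.compose∈ r pp m))
  (λ n → let (ab , m , e) = compose-surjective r pp n in subst (_∈ map (compose p) (factorisations r p)) (sym e) (∈-map⁺ (compose p) m))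

-- Sums

sumOver : List A → (A → ℤ) → ℤ
sumOver xs f = foldr ℤ._+_ 0ℤ (map f xs)

sumOver-↭ : (f : A → ℤ) {xs ys : List A} → xs ↭ ys → sumOver xs f ≡ sumOver ys f
sumOver-↭ f p = ↭ₛ.foldr-commMonoid (setoid ℤ) ℤ.+-0-isCommutativeMonoid (↭⇒↭ₛ (↭-map⁺ f p))

sumOver-map : (g : A → B) (f : B → ℤ) (xs : List A) → sumOver (map g xs) f ≡ sumOver xs (f ∘ g)
sumOver-map g f xs = cong (foldr ℤ._+_ 0ℤ) (sym (map-∘ xs))

sumOver-cong : {f g : A → ℤ} (xs : List A) → (∀ {x} → x ∈ xs → f x ≡ g x) → sumOver xs f ≡ sumOver xs g
sumOver-cong xs H = cong (foldr ℤ._+_ 0ℤ) (map-cong-local (All.tabulate H))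

sumOver-++ : (f : A → ℤ) (xs ys : List A) → sumOver (xs ++ ys) f ≡ sumOver xs f ℤ.+ sumOver ys f
sumOver-++ f [] ys = sym (ℤ.+-identityˡ (sumOver ys f))
sumOver-++ f (x ∷ xs) ys = trans (cong (λ k → f x ℤ.+ k) (sumOver-++ f xs ys)) (sym (ℤ.+-assoc (f x) (sumOver xs f) (sumOver ys f)))

sumOver-concatMap : (g : A → List B) (f : B → ℤ) (xs : List A) →
  sumOver (concatMap g xs) f ≡ sumOver xs (λ x → sumOver (g x) f)
sumOver-concatMap g f [] = refl
sumOver-concatMap g f (x ∷ xs) =
  trans (sumOver-++ f (g x) (concatMap g xs)) (cong (λ k → sumOver (g x) f ℤ.+ k) (sumOver-concatMap g f xs))

Σᴱ-apply : (f : A → Elt) (xs : List A) (k : Pair) → Σᴱ (map f xs) k ≡ sumOver xs (λ x → f x k)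
Σᴱ-apply f [] k = refl
Σᴱ-apply f (x ∷ xs) k = cong (λ z → f x k ℤ.+ z) (Σᴱ-apply f xs k)

sum-factorisations : ∀ r {p} → IsPair p → (f : Pair → ℤ) →
  sumOver (arrowsFrom₊ p) (f ∘ target) ≡
  sumOver (ruleArrows r p) (λ a → sumOver (reverseArrows r (target a)) (f ∘ target))
sum-factorisations r {p} pp f = begin
  sumOver (arrowsFrom₊ p) (f ∘ target)
    ≡⟨ sumOver-↭ (f ∘ target) (factorisations↭arrows r pp) ⟨
  sumOver (map (compose p) (factorisations r p)) (f ∘ target)
    -- A composite has the target of its second factor by definition.
    ≡⟨ sumOver-map (compose p) (f ∘ target) (factorisations r p) ⟩
  sumOver (factorisations r p) (λ ab → f (target (proj₂ ab)))
    ≡⟨ sumOver-concatMap (λ a → map (a ,_) (reverseArrows r (target a))) _ (ruleArrows r p) ⟩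
  sumOver (ruleArrows r p) (λ a → sumOver (map (a ,_) (reverseArrows r (target a))) (λ ab → f (target (proj₂ ab))))
    ≡⟨ sumOver-cong (ruleArrows r p) (λ {a} _ → sumOver-map (a ,_) _ (reverseArrows r (target a))) ⟩
  sumOver (ruleArrows r p) (λ a → sumOver (reverseArrows r (target a)) (f ∘ target)) ∎
  where open ≡-Reasoning

-- The identity has no labelled boxes, so the rule holds for it vacuously.
ruleArrows-identity : ∀ r p → ruleArrows r p ≡ identity p ∷ filterᵇ (satisfiesRowRule r p) (arrowsFrom p)
ruleArrows-identity r p = cong (λ b → if b then identity p ∷ xs else xs) ok
  where
  xs = filterᵇ (satisfiesRowRule r p) (arrowsFrom p)
  ok : satisfiesRowRule r p (identity p) ≡ true
  ok rewrite rlBoxes-empty (proj₂ p) = refl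

reverseArrows-identity : ∀ r p → reverseArrows r p ≡ identity p ∷ filterᵇ (satisfiesReverseRowRule r p) (arrowsFrom p)
reverseArrows-identity r p = cong (λ b → if b then identity p ∷ xs else xs) ok
  where
  xs = filterᵇ (satisfiesReverseRowRule r p) (arrowsFrom p)
  ok : satisfiesReverseRowRule r p (identity p) ≡ true
  ok rewrite rlBoxes-empty (proj₂ p) = refl

-- Bases

target-isPair : ∀ p {a} → a ∈ arrowsFrom p → IsPair (target a)
target-isPair p m = proj₁ (proj₂ (∈-arrowsFrom⁻ p m))

-- Unfolding `w` at a vertex leaves its targets with the remaining fuel, while `w` at a target
-- starts with fuel of its own. The decrease of size along arrows shows that both suffice.
wFuel-stable : ∀ f f′ {p} → IsPair p → size (proj₂ p) < f → size (proj₂ p) < f′ → wFuel f p ≗ wFuel f′ p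
wFuel-stable (suc f) (suc f′) {p} pp l l′ k = cong (λ z → s p k ℤ.- z) (begin
  Σᴱ (map (λ a → wFuel f (target a)) (arrowsFrom p)) k   ≡⟨ Σᴱ-apply _ (arrowsFrom p) k ⟩
  sumOver (arrowsFrom p) (λ a → wFuel f (target a) k)    ≡⟨ sumOver-cong (arrowsFrom p) step ⟩
  sumOver (arrowsFrom p) (λ a → wFuel f′ (target a) k)   ≡⟨ Σᴱ-apply _ (arrowsFrom p) k ⟨
  Σᴱ (map (λ a → wFuel f′ (target a)) (arrowsFrom p)) k  ∎)
  where
  open ≡-Reasoning
  step : ∀ {a} → a ∈ arrowsFrom p → wFuel f (target a) k ≡ wFuel f′ (target a) k
  step m = wFuel-stable f f′ (target-isPair p m)
    (<-≤-trans (target-smaller pp m) (s≤s⁻¹ l)) (<-≤-trans (target-smaller pp m) (s≤s⁻¹ l′)) k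

-- The recursion for `w` with its sum moved to the other side; the identity accounts for the term
-- `w p`.
s-as-sum-of-w : ∀ {p} → IsPair p → ∀ k → s p k ≡ sumOver (arrowsFrom₊ p) (λ a → w (target a) k)
s-as-sum-of-w {p} pp k = trans (sym ([i-j]+j≡i (s p k) _)) (cong (λ z → w p k ℤ.+ z) (trans
  (Σᴱ-apply _ (arrowsFrom p) k)
  (sumOver-cong (arrowsFrom p) λ m → wFuel-stable _ _ (target-isPair p m) (target-smaller pp m) ≤-refl k)))

τ-candidate : ℕ → Pair → Elt
τ-candidate r p k = sumOver (reverseArrows r p) (λ a → w (target a) k)

tauFuel-candidate : ∀ r f {p} → IsPair p → size (proj₂ p) < f → tauFuel r f p ≗ τ-candidate r p
tauFuel-candidate r (suc f) {p} pp l k = begin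
  s p k ℤ.- Σᴱ (map (λ a → tauFuel r f (target a)) rules) k
    ≡⟨ cong (λ z → s p k ℤ.- z) (trans (Σᴱ-apply _ rules k) (sumOver-cong rules step)) ⟩
  s p k ℤ.- S
    -- Among the row-rule arrows, the identity contributes the candidate at `p`, and the others
    -- contribute exactly the subtracted `S`.
    ≡⟨ cong (ℤ._- S) (trans (s-as-sum-of-w pp k) (trans (sum-factorisations r pp (λ q → w q k))
         (cong (λ as → sumOver as (λ a → τ-candidate r (target a) k)) (ruleArrows-identity r p)))) ⟩
  (τ-candidate r p k ℤ.+ S) ℤ.- S
    ≡⟨ [i+j]-j≡i (τ-candidate r p k) S ⟩
  τ-candidate r p k ∎
  where
  open ≡-Reasoning
  rules = filterᵇ (satisfiesRowRule r p) (arrowsFrom p)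
  S = sumOver rules (λ a → τ-candidate r (target a) k)
  step : ∀ {a} → a ∈ rules → tauFuel r f (target a) k ≡ τ-candidate r (target a) k
  step m = let m′ = proj₁ (∈-filterᵇ⁻ (satisfiesRowRule r p) (arrowsFrom p) m) in
    tauFuel-candidate r f (target-isPair p m′) (<-≤-trans (target-smaller pp m′) (s≤s⁻¹ l)) k

mainTheorem7 : (α₁ α₂ : Partition) → T (isPartition α₁) → T (isPartition α₂) →
    (r : ℕ) → 1 ≤ r →
    τ r (α₁ , α₂) ≗
    w (α₁ , α₂) +ᴱ Σᴱ (map (λ a → w (target a))
    (filterᵇ (satisfiesReverseRowRule r (α₁ , α₂)) (arrowsFrom (α₁ , α₂))))
mainTheorem7 α₁ α₂ t₁ t₂ r _ k = begin
  τ r p k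
    ≡⟨ tauFuel-candidate r _ (isPartition⁻ α₁ t₁ , isPartition⁻ α₂ t₂) ≤-refl k ⟩
  τ-candidate r p k
    ≡⟨ cong (λ as → sumOver as (λ a → w (target a) k)) (reverseArrows-identity r p) ⟩
  w p k ℤ.+ sumOver reverses (λ a → w (target a) k)
    ≡⟨ cong (λ z → w p k ℤ.+ z) (Σᴱ-apply _ reverses k) ⟨
  w p k ℤ.+ Σᴱ (map (λ a → w (target a)) reverses) k ∎
  where
  open ≡-Reasoning
  p = α₁ , α₂
  reverses = filterᵇ (satisfiesReverseRowRule r p) (arrowsFrom p)
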